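{- $\textsc{\#MonotoneSat}$ is hard for $\#\mathsf{\Pi_2\text{ - }1VAR}$ under product reductions: for every $\#B\in\#\mathsf{\Pi_2\text{ - }1VAR}$ (over a vocabulary $\sigma$) there are polynomial-time computable functions $g,h$ such that for every input $\sigma$-structure $\mathcal{A}$, $g(\mathcal{A})$ is a monotone CNF formula and $\#B(\mathcal{A})=\textsc{\#MonotoneSat}(g(\mathcal{A}))\cdot h(\mathcal{A})$.
   Context: $\textsc{\#MonotoneSat}$: given a propositional CNF formula in which all literals are positive, output its number of satisfying assignments. A counting problem $\#B$ on finite ordered $\sigma$-structures belongs to $\#\mathsf{\Pi_2\text{ - }1VAR}$ if there is a formula $\psi(\vec y,\vec z,X)=\phi(\vec y,\vec z)\wedge X(\vec z)$, with $\phi$ a first-order formula over $\sigma$ and $X$ a single second-order variable (occurring positively), such that for every input structure $\mathcal{A}$, $\#B(\mathcal{A})=|\{\langle X\rangle : \mathcal{A}\models\forall\vec y\exists\vec z\,\psi(\vec y,\vec z,X)\}|$. A product reduction from $f$ to $g'$ is a pair of polynomial-time computable functions $h_1,h_2$ with $f(x)=g'(h_1(x))\cdot h_2(x)$ for all $x$. -}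

module Defs where

open import Data.Nat using (ℕ; zero; suc; _+_; _*_; _^_; _≤ᵇ_)
open import Data.Nat.Binary.Base as Bin using (ℕᵇ; 2[1+_]; 1+[2_])
open import Data.Bool using (Bool; true; false; _∧_; _∨_; not; if_then_else_)
open import Data.Fin using (Fin; zero; suc; toℕ; combine)
open import Data.Fin.Properties using (_≟_)
open import Data.List using (List; []; _∷_; [_]; length; map; concat; concatMap; allFin; replicate; _++_; lookup)
open import Data.Bool.ListAction using (all; any)
open import Data.Vec as Vec using (Vec; []; _∷_)
open import Data.Maybe using (Maybe; just; nothing)
open import Data.Product using (Σ; _×_; _,_; ∃)
open import Relation.Nullary.Decidable using (⌊_⌋)
open import Relation.Binary.PropositionalEquality using (_≡_)

allTuples : (n k : ℕ) → List (Vec (Fin n) k)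
allTuples n zero    = [ [] ]
allTuples n (suc k) = concatMap (λ x → map (x ∷_) (allTuples n k)) (allFin n)

allBoolVecs : (N : ℕ) → List (Vec Bool N)
allBoolVecs zero    = [ [] ]
allBoolVecs (suc N) = concatMap (λ b → map (b ∷_) (allBoolVecs N)) (false ∷ true ∷ [])

countTrue : {A : Set} → (A → Bool) → List A → ℕ
countTrue p []       = 0
countTrue p (x ∷ xs) = (if p x then 1 else 0) + countTrue p xs

-- a relational vocabulary: the list of arities of its relation symbols
Vocabulary : Set
Vocabulary = List ℕ

-- a finite ordered σ-structure: universe {0,…,n-1} with its natural
-- linear order, and an interpretation of every relation symbol
record Structure (σ : Vocabulary) : Set where
  field
    size : ℕ
    rel  : (i : Fin (length σ)) → Vec (Fin size) (lookup σ i) → Bool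
open Structure public

data Formula (σ : Vocabulary) : ℕ → Set where
  atom   : ∀ {m} (i : Fin (length σ)) → Vec (Fin m) (lookup σ i) → Formula σ m
  equal  : ∀ {m} → Fin m → Fin m → Formula σ m
  lessEq : ∀ {m} → Fin m → Fin m → Formula σ m
  neg    : ∀ {m} → Formula σ m → Formula σ m
  conj   : ∀ {m} → Formula σ m → Formula σ m → Formula σ m
  disj   : ∀ {m} → Formula σ m → Formula σ m → Formula σ m
  forAll : ∀ {m} → Formula σ (suc m) → Formula σ m   -- binds variable 0
  exists : ∀ {m} → Formula σ (suc m) → Formula σ m   -- binds variable 0

eval : ∀ {σ m} (A : Structure σ) → Formula σ m → Vec (Fin (size A)) m → Bool
eval A (atom i xs)  env = rel A i (Vec.map (λ x → Vec.lookup env x) xs)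
eval A (equal x y)  env = ⌊ Vec.lookup env x ≟ Vec.lookup env y ⌋
eval A (lessEq x y) env = toℕ (Vec.lookup env x) ≤ᵇ toℕ (Vec.lookup env y)
eval A (neg φ)      env = not (eval A φ env)
eval A (conj φ ψ)   env = eval A φ env ∧ eval A ψ env
eval A (disj φ ψ)   env = eval A φ env ∨ eval A ψ env
eval A (forAll φ)   env = all (λ d → eval A φ (d ∷ env)) (allFin (size A))
eval A (exists φ)   env = any (λ d → eval A φ (d ∷ env)) (allFin (size A))

tupleIndex : ∀ {n b} → Vec (Fin n) b → Fin (n ^ b)
tupleIndex []       = zero
tupleIndex (x ∷ xs) = combine x (tupleIndex xs)

-- a relation X ⊆ A^b, given by its characteristic vector
Rel2 : (n b : ℕ) → Set
Rel2 n b = Vec Bool (n ^ b)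

memberX : ∀ {n b} → Rel2 n b → Vec (Fin n) b → Bool
memberX X z = Vec.lookup X (tupleIndex z)

satΠ2 : ∀ {σ} (a b : ℕ) → Formula σ (a + b) → (A : Structure σ) → Rel2 (size A) b → Bool
satΠ2 a b φ A X =
  all (λ y → any (λ z → eval A φ (y Vec.++ z) ∧ memberX X z) (allTuples (size A) b))
      (allTuples (size A) a)

countΠ2 : ∀ {σ} (a b : ℕ) → Formula σ (a + b) → Structure σ → ℕ
countΠ2 a b φ A = countTrue (satΠ2 a b φ A) (allBoolVecs (size A ^ b))

-- a CNF with N variables all of whose literals are positive:
-- a list of clauses, each clause a list of variables
record MonCNF : Set where
  field
    nvars   : ℕ
    clauses : List (List (Fin nvars))
open MonCNF public

satMon : (F : MonCNF) → Vec Bool (nvars F) → Bool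
satMon F v = all (λ c → any (λ x → Vec.lookup v x) c) (clauses F)

#MonotoneSat : MonCNF → ℕ
#MonotoneSat F = countTrue (satMon F) (allBoolVecs (nvars F))

-- self-delimiting binary encoding of natural numbers (bijective base 2,
-- each digit preceded by a 1, terminated by a 0); length O(log n)
encℕᵇ : ℕᵇ → List Bool
encℕᵇ Bin.zero   = false ∷ []
encℕᵇ 2[1+ x ]   = true ∷ true ∷ encℕᵇ x
encℕᵇ 1+[2 x ]   = true ∷ false ∷ encℕᵇ x

encℕ : ℕ → List Bool
encℕ n = encℕᵇ (Bin.fromℕ n)

encFin : ∀ {N} → Fin N → List Bool
encFin i = encℕ (toℕ i)

encStructure : ∀ {σ} → Structure σ → List Bool
encStructure {σ} A =
  replicate (size A) true ++ false ∷
  concatMap (λ i → map (rel A i) (allTuples (size A) (lookup σ i))) (allFin (length σ))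

encList : {A : Set} → (A → List Bool) → List A → List Bool
encList e xs = encℕ (length xs) ++ concatMap e xs

encMonCNF : MonCNF → List Bool
encMonCNF F = encℕ (nvars F) ++ encList (encList encFin) (clauses F)

-- Deterministic Turing machines (single two-way infinite tape) and
-- polynomial-time computability

data Move : Set where
  left right stay : Move

-- tape symbols: 0 = blank, 1 = bit 0, 2 = bit 1, the rest auxiliary
Sym : ℕ → Set
Sym k = Fin (3 + k)

record TM : Set where
  field
    nstates : ℕ
    naux    : ℕ
    start   : Fin nstates
    -- nothing = halt
    δ       : Fin nstates → Sym naux → Maybe (Fin nstates × Sym naux × Move)

record Config (M : TM) : Set where
  constructor config
  field
    state : Fin (TM.nstates M)
    lefts : List (Sym (TM.naux M))    -- cells left of the head, nearest first
    head  : Sym (TM.naux M)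
    rights : List (Sym (TM.naux M))   -- cells right of the head, nearest first

blank : ∀ {k} → Sym k
blank = zero

bitSym : ∀ {k} → Bool → Sym k
bitSym false = suc zero
bitSym true  = suc (suc zero)

moveHead : ∀ {M} → Fin (TM.nstates M) → List (Sym (TM.naux M)) → Sym (TM.naux M) →
           List (Sym (TM.naux M)) → Move → Config M
moveHead q ls       h rs       stay  = config q ls h rs
moveHead q []       h rs       left  = config q [] blank (h ∷ rs)
moveHead q (l ∷ ls) h rs       left  = config q ls l (h ∷ rs)
moveHead q ls       h []       right = config q (h ∷ ls) blank []
moveHead q ls       h (r ∷ rs) right = config q (h ∷ ls) r rs

step : (M : TM) → Config M → Maybe (Config M)
step M (config q ls h rs) with TM.δ M q h
... | nothing            = nothing
... | just (q' , s , mv) = just (moveHead {M} q' ls s rs mv)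

runWithin : (M : TM) → ℕ → Config M → Maybe (Config M)
runWithin M t c with step M c
runWithin M t       c | nothing = just c
runWithin M zero    c | just _  = nothing
runWithin M (suc t) c | just c' = runWithin M t c'

initConfig : (M : TM) → List Bool → Config M
initConfig M []       = config (TM.start M) [] blank []
initConfig M (b ∷ bs) = config (TM.start M) [] (bitSym b) (map bitSym bs)

-- the output: the maximal bit string starting at the head position
readBits : ∀ {k} → List (Sym k) → List Bool
readBits []                       = []
readBits (zero ∷ _)               = []
readBits (suc zero ∷ ss)          = false ∷ readBits ss
readBits (suc (suc zero) ∷ ss)    = true ∷ readBits ss
readBits (suc (suc (suc _)) ∷ _)  = []

output : ∀ {M} → Config M → List Bool
output (config _ _ h rs) = readBits (h ∷ rs)

PolyTime : {A B : Set} → (A → List Bool) → (B → List Bool) → (A → B) → Set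
PolyTime {A} encA encB f =
  Σ TM λ M → Σ ℕ λ c → Σ ℕ λ k → (x : A) →
    Σ (Config M) λ cf →
      (runWithin M (c * suc (length (encA x)) ^ k) (initConfig M (encA x)) ≡ just cf)
      × (output cf ≡ encB (f x))

{-# OPTIONS --safe #-}
module Submission where

-- A clause per tuple y, consisting of the tuples z with φ(y, z), turns the sentence ∀y ∃z (φ ∧ X(z))
-- into a monotone CNF over the variables X(z) with the same satisfying assignments, so h = 1. The
-- CNF can be printed by nested loops over the universe that keep nothing but the loop variables, a
-- pointer into the input, one flag and one counter. Such a loop program runs on a tape with the
-- counter (in bijective base 2) on the left, the input in the middle, each input cell carrying unary
-- marks for the loop variables and the pointer, and the growing output on the right: an elementary
-- operation is then a bounded number of walks along the tape and back, except that printing the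
-- counter takes a bounded number of walks per digit.

open import Defs
open import Data.Nat using (ℕ; zero; suc; pred; _+_; _*_; _^_; _≤_; _<_; z≤n; s≤s; _<ᵇ_; _≤ᵇ_; _⊔_)
open import Data.Nat.Properties hiding (_≟_)
open import Data.Nat.Tactic.RingSolver using (solve-∀)
open import Data.Nat.Binary.Base as Bin using (ℕᵇ; 2[1+_]; 1+[2_]; fromℕ')
open import Data.Nat.Binary.Properties using (fromℕ≡fromℕ')
open import Data.Bool using (Bool; true; false; not; _∧_; _∨_; if_then_else_)
open import Data.Bool.Properties using (if-eta)
open import Data.Bool.ListAction using (all; any)
open import Data.Fin using (Fin; zero; suc; toℕ)
open import Data.Fin.Properties using (+↔⊎; *↔×; 1↔⊤; 2↔Bool; _≟_; toℕ<n; toℕ-combine; toℕ-injective)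
open import Data.List using (List; []; _∷_; map; _++_; length; replicate; concat; concatMap; _∷ʳ_; _ʳ++_;
  allFin; tabulate; lookup; filterᵇ)
open import Data.List.Properties
open import Data.List.Membership.Propositional using (_∈_)
open import Data.List.Membership.Propositional.Properties using (∈-concatMap⁺; ∈-map⁺; ∈-allFin)
open import Data.List.Relation.Unary.All using (All; []; _∷_)
import Data.List.Relation.Unary.All.Properties as All
open import Data.List.Relation.Unary.Any as Any using (here; there)
open import Data.Maybe using (Maybe; just; nothing; maybe′)
open import Data.Product using (Σ; ∃; ∃₂; _×_; _,_; proj₁; proj₂; map₂; uncurry)
open import Data.Product.Function.NonDependent.Propositional using (_×-↔_)
open import Data.Sum using (_⊎_; inj₁; inj₂)
open import Data.Sum.Function.Propositional using (_⊎-↔_)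
open import Data.Unit using (⊤; tt)
open import Data.Vec as Vec using (Vec; []; _∷_)
import Data.Vec.Properties as Vec
open import Function using (_∘_; id; const; _↔_; Inverse; mk↔ₛ′)
open import Function.Properties.Inverse using (↔-trans; ↔-sym)
open import Relation.Binary.PropositionalEquality
open import Relation.Nullary using (contradiction; yes; no)
open import Relation.Nullary.Decidable using (⌊_⌋)

-- `PolyTime` asks for a concrete machine with an explicit time bound, so most of the work goes into
-- producing one machine for each φ. The encoding opens with the universe in unary, so elements and
-- input positions fit as unary marks on the input cells, while the counter, which reaches n^b,
-- needs a region of its own. Lists in the CNF encoding are prefixed by their lengths, so each
-- clause takes two passes over the tuples z: one counts the literals, the other prints them. One
-- counter suffices because `allTuples` follows the order of `tupleIndex`: the number of tuples
-- already visited is the index to print. Costs are counted in sweeps. A sweep adds at most one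
-- cell, so polynomially many sweeps take polynomial time. The counter never exceeds the number of
-- operations, and even this crude bound on its number of digits is enough.

Finite : Set → Set
Finite A = Σ ℕ λ n → A ↔ Fin n

finite-⊤ : Finite ⊤
finite-⊤ = 1 , ↔-sym 1↔⊤

finite-Bool : Finite Bool
finite-Bool = 2 , ↔-sym 2↔Bool

finite-⊎ : ∀ {A B} → Finite A → Finite B → Finite (A ⊎ B)
finite-⊎ (m , e) (n , f) = m + n , ↔-trans (e ⊎-↔ f) (↔-sym +↔⊎)

finite-× : ∀ {A B} → Finite A → Finite B → Finite (A × B)
finite-× (m , e) (n , f) = m * n , ↔-trans (e ×-↔ f) (↔-sym *↔×)

finite-Vec : ∀ {A} → Finite A → ∀ k → Finite (Vec A k)
finite-Vec e zero = 1 , ↔-trans (mk↔ₛ′ (λ _ → tt) (λ _ → []) (λ _ → refl) λ { [] → refl }) (↔-sym 1↔⊤)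
finite-Vec e (suc k) with finite-× e (finite-Vec e k)
... | n , f = n , ↔-trans (mk↔ₛ′ Vec.uncons (uncurry _∷_) (λ _ → refl) λ { (_ ∷ _) → refl }) f

-- Structured tape programs as Turing machines

data Symbol (Aux : Set) : Set where
  □   : Symbol Aux
  bit : Bool → Symbol Aux
  aux : Aux → Symbol Aux

-- The blank and the two bits must get the codes fixed by `Sym`, since the initial tape and the
-- output are read through them.
symbol↔Fin : ∀ {Aux k} → Aux ↔ Fin k → Symbol Aux ↔ Sym k
symbol↔Fin {Aux} {k} e = mk↔ₛ′ to from to-from from-to
  where
  module E = Inverse e
  to : Symbol Aux → Sym k
  to □       = blank
  to (bit b) = bitSym b
  to (aux x) = suc (suc (suc (E.to x)))
  from : Sym k → Symbol Aux
  from zero                = □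
  from (suc zero)          = bit false
  from (suc (suc zero))    = bit true
  from (suc (suc (suc i))) = aux (E.from i)
  to-from : ∀ i → to (from i) ≡ i
  to-from zero                = refl
  to-from (suc zero)          = refl
  to-from (suc (suc zero))    = refl
  to-from (suc (suc (suc i))) = cong (λ j → suc (suc (suc j))) (E.strictlyInverseˡ i)
  from-to : ∀ x → from (to x) ≡ x
  from-to □           = refl
  from-to (bit false) = refl
  from-to (bit true)  = refl
  from-to (aux x)     = cong aux (E.strictlyInverseʳ x)

module _ {Γ : Set} where

  data Program : Set where
    act    : (Γ → Γ × Move) → Program
    _»_    : Program → Program → Program
    branch : (Γ → Bool) → Program → Program → Program
    while  : (Γ → Bool) → Program → Program

  infixr 5 _»_

  State : Program → Set
  State (act _)        = ⊤
  State (P » Q)        = State P ⊎ State Q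
  State (branch _ P Q) = ⊤ ⊎ (State P ⊎ State Q)
  State (while _ P)    = ⊤ ⊎ State P

  finite-State : ∀ P → Finite (State P)
  finite-State (act _)        = finite-⊤
  finite-State (P » Q)        = finite-⊎ (finite-State P) (finite-State Q)
  finite-State (branch _ P Q) = finite-⊎ finite-⊤ (finite-⊎ (finite-State P) (finite-State Q))
  finite-State (while _ P)    = finite-⊎ finite-⊤ (finite-State P)

  entry : ∀ P → State P
  entry (act _)        = tt
  entry (P » Q)        = inj₁ (entry P)
  entry (branch _ P Q) = inj₁ tt
  entry (while _ P)    = inj₁ tt

  -- Glues a part into a whole: `e` renames the states of the part, and `k` is where control goes
  -- when the part terminates.
  redirect : ∀ {S T : Set} → (S → T) → T → Maybe S × Γ × Move → T × Γ × Move
  redirect e k (s , a) = maybe′ e k s , a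

  -- nothing: the program has terminated
  transition : ∀ P → State P → Γ → Maybe (State P) × Γ × Move
  transition (act f) tt x = nothing , f x
  transition (P » Q) (inj₁ s) x =
    redirect (λ s′ → just (inj₁ s′)) (just (inj₂ (entry Q))) (transition P s x)
  transition (P » Q) (inj₂ s) x =
    redirect (λ s′ → just (inj₂ s′)) nothing (transition Q s x)
  transition (branch p P Q) (inj₁ tt) x with p x
  ... | true  = just (inj₂ (inj₁ (entry P))) , x , stay
  ... | false = just (inj₂ (inj₂ (entry Q))) , x , stay
  transition (branch p P Q) (inj₂ (inj₁ s)) x =
    redirect (λ s′ → just (inj₂ (inj₁ s′))) nothing (transition P s x)
  transition (branch p P Q) (inj₂ (inj₂ s)) x =
    redirect (λ s′ → just (inj₂ (inj₂ s′))) nothing (transition Q s x)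
  transition (while p P) (inj₁ tt) x with p x
  ... | true  = just (inj₂ (entry P)) , x , stay
  ... | false = nothing , x , stay
  transition (while p P) (inj₂ s) x =
    redirect (λ s′ → just (inj₂ s′)) (just (inj₁ tt)) (transition P s x)

  module _ {p : Γ → Bool} {P Q : Program} {x : Γ} where

    branch-then : p x ≡ true → transition (branch p P Q) (inj₁ tt) x ≡ (just (inj₂ (inj₁ (entry P))) , x , stay)
    branch-then eq rewrite eq = refl

    branch-else : p x ≡ false → transition (branch p P Q) (inj₁ tt) x ≡ (just (inj₂ (inj₂ (entry Q))) , x , stay)
    branch-else eq rewrite eq = refl

  module _ {p : Γ → Bool} {P : Program} {x : Γ} where

    while-stop : p x ≡ false → transition (while p P) (inj₁ tt) x ≡ (nothing , x , stay)
    while-stop eq rewrite eq = refl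

    while-again : p x ≡ true → transition (while p P) (inj₁ tt) x ≡ (just (inj₂ (entry P)) , x , stay)
    while-again eq rewrite eq = refl

record Tape (Γ : Set) : Set where
  constructor tape
  field
    lefts  : List Γ
    head   : Γ
    rights : List Γ

module _ {Aux : Set} where

  private
    Γ = Symbol Aux

  move : Tape Γ → Γ × Move → Tape Γ
  move (tape ls       _ rs)       (x , stay)  = tape ls x rs
  move (tape []       _ rs)       (x , left)  = tape [] □ (x ∷ rs)
  move (tape (l ∷ ls) _ rs)       (x , left)  = tape ls l (x ∷ rs)
  move (tape ls       _ [])       (x , right) = tape (x ∷ ls) □ []
  move (tape ls       _ (r ∷ rs)) (x , right) = tape (x ∷ ls) r rs

  inputTape : List Bool → Tape Γ
  inputTape []       = tape [] □ []
  inputTape (b ∷ bs) = tape [] (bit b) (map bit bs)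

  readSymbols : List Γ → List Bool
  readSymbols (bit b ∷ xs) = b ∷ readSymbols xs
  readSymbols _            = []

  -- P ⊢ T ⇓[ t ] T′ : started on T, the program P stops on T′ after at most t steps.
  infix 3 _⊢_⇓[_]_

  data _⊢_⇓[_]_ : Program → Tape Γ → ℕ → Tape Γ → Set where
    run-act   : ∀ {f T} → act f ⊢ T ⇓[ 1 ] move T (f (Tape.head T))
    run-»     : ∀ {P Q T U V t u} → P ⊢ T ⇓[ t ] U → Q ⊢ U ⇓[ u ] V → P » Q ⊢ T ⇓[ t + u ] V
    run-then  : ∀ {p P Q T U t} → p (Tape.head T) ≡ true →
                P ⊢ T ⇓[ t ] U → branch p P Q ⊢ T ⇓[ suc t ] U
    run-else  : ∀ {p P Q T U t} → p (Tape.head T) ≡ false →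
                Q ⊢ T ⇓[ t ] U → branch p P Q ⊢ T ⇓[ suc t ] U
    run-stop  : ∀ {p P T} → p (Tape.head T) ≡ false → while p P ⊢ T ⇓[ 1 ] T
    run-again : ∀ {p P T U V t u} → p (Tape.head T) ≡ true → P ⊢ T ⇓[ t ] U →
                while p P ⊢ U ⇓[ u ] V → while p P ⊢ T ⇓[ suc (t + u) ] V
    slack     : ∀ {P T U t u} → t ≤ u → P ⊢ T ⇓[ t ] U → P ⊢ T ⇓[ u ] U

-- Compilation to Turing machines

module _ (M : TM) where

  data Reach : Config M → ℕ → Config M → Set where
    here : ∀ {c t} → Reach c t c
    next : ∀ {c c′ c″ t} → step M c ≡ just c′ → Reach c′ t c″ → Reach c (suc t) c″

  reach-slack : ∀ {c c′ t u} → t ≤ u → Reach c t c′ → Reach c u c′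
  reach-slack t≤u       here       = here
  reach-slack (s≤s t≤u) (next s r) = next s (reach-slack t≤u r)

  reach-trans : ∀ {c c′ c″ t u} → Reach c t c′ → Reach c′ u c″ → Reach c (t + u) c″
  reach-trans {t = t} {u} here       r′ = reach-slack (m≤n+m u t) r′
  reach-trans             (next s r) r′ = next s (reach-trans r r′)

  runWithin-halt : ∀ {c} t → step M c ≡ nothing → runWithin M t c ≡ just c
  runWithin-halt t       eq rewrite eq = refl

  runWithin-reach : ∀ {c c′ t} → Reach c t c′ → step M c′ ≡ nothing → runWithin M t c ≡ just c′
  runWithin-reach {t = t} here      halted = runWithin-halt t halted
  runWithin-reach (next s r) halted rewrite s = runWithin-reach r halted

module Compile {Aux : Set} (finiteAux : Finite Aux) (main : Program {Symbol Aux}) where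

  private
    Γ = Symbol Aux
    k = proj₁ finiteAux
    module Sy = Inverse (symbol↔Fin (proj₂ finiteAux))
    module St = Inverse (proj₂ (finite-State main))
    n = proj₁ (finite-State main)

  -- Index 0 is reserved for the halting state.
  stateIndex : State main → Fin (suc n)
  stateIndex s = suc (St.to s)

  instruction : Fin (suc n) × Γ × Move → Fin (suc n) × Sym k × Move
  instruction (q , x , mv) = q , Sy.to x , mv

  machine : TM
  machine = record
    { nstates = suc n ; naux = k ; start = stateIndex (entry main)
    ; δ = λ { zero    _ → nothing
            ; (suc i) x → just (instruction
                (redirect stateIndex zero (transition main (St.from i) (Sy.from x)))) } }

  conf : Fin (suc n) → Tape Γ → Config machine
  conf q (tape ls h rs) = config q (map Sy.to ls) (Sy.to h) (map Sy.to rs)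

  -- The simulation is proved for all parts of `main` at once: the transition table contains a copy
  -- of P, with states named by `e` and exit `k`.
  Embeds : ∀ P → (State P → Fin (suc n)) → Fin (suc n) → Set
  Embeds P e k = ∀ s x → TM.δ machine (e s) (Sy.to x) ≡
                         just (instruction (redirect e k (transition P s x)))

  embeds-main : Embeds main stateIndex zero
  embeds-main s x rewrite St.strictlyInverseʳ s | Sy.strictlyInverseʳ x = refl

  step-conf : ∀ q T {q′ x mv} → TM.δ machine q (Sy.to (Tape.head T)) ≡ just (q′ , Sy.to x , mv) →
              step machine (conf q T) ≡ just (conf q′ (move T (x , mv)))
  step-conf q (tape []       h rs)       {mv = left}  eq rewrite eq = refl
  step-conf q (tape (l ∷ ls) h rs)       {mv = left}  eq rewrite eq = refl
  step-conf q (tape ls       h [])       {mv = right} eq rewrite eq = refl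
  step-conf q (tape ls       h (r ∷ rs)) {mv = right} eq rewrite eq = refl
  step-conf q (tape ls       h rs)       {mv = stay}  eq rewrite eq = refl

  one-step : ∀ q T {q′ x mv} → TM.δ machine q (Sy.to (Tape.head T)) ≡ just (q′ , Sy.to x , mv) →
             Reach machine (conf q T) 1 (conf q′ (move T (x , mv)))
  one-step q T eq = next (step-conf q T eq) here

  obey : ∀ P e k → Embeds P e k → ∀ s T {m x mv} → transition P s (Tape.head T) ≡ (m , x , mv) →
         Reach machine (conf (e s) T) 1 (conf (maybe′ e k m) (move T (x , mv)))
  obey P e k em s T eq =
    one-step _ T (trans (em s _) (cong (λ z → just (instruction (redirect e k z))) eq))

  embeds-part : ∀ R P e k (i : State P → State R) m → Embeds R e k →
                (∀ s x → transition R (i s) x ≡ redirect (λ s′ → just (i s′)) m (transition P s x)) →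
                Embeds P (λ s → e (i s)) (maybe′ e k m)
  embeds-part R P e k i m em part s x =
    trans (em (i s) x) (cong (λ z → just (instruction z))
      (trans (cong (redirect e k) (part s x)) (merge (transition P s x))))
    where
    merge : ∀ z → redirect e k (redirect (λ s′ → just (i s′)) m z) ≡
                  redirect (λ s′ → e (i s′)) (maybe′ e k m) z
    merge (just _  , _) = refl
    merge (nothing , _) = refl

  -- Induction on the derivation of the run, not on the program: the second half of `run-again` is a
  -- run of the same loop under the same embedding.
  simulate : ∀ P e k {T t U} → Embeds P e k → P ⊢ T ⇓[ t ] U →
             Reach machine (conf (e (entry P)) T) t (conf k U)
  simulate P@(act _) e k {T} em run-act = obey P e k em tt T refl
  simulate R@(P » Q) e k em (run-» r r′) = reach-trans machine
    (simulate P _ _ (embeds-part R P e k inj₁ (just (inj₂ (entry Q))) em (λ _ _ → refl)) r)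
    (simulate Q _ _ (embeds-part R Q e k inj₂ nothing em (λ _ _ → refl)) r′)
  simulate R@(branch p P Q) e k {T} em (run-then eq r) = reach-trans machine
    (obey R e k em (inj₁ tt) T (branch-then {p = p} {P} {Q} eq))
    (simulate P _ _ (embeds-part R P e k (λ s → inj₂ (inj₁ s)) nothing em (λ _ _ → refl)) r)
  simulate R@(branch p P Q) e k {T} em (run-else eq r) = reach-trans machine
    (obey R e k em (inj₁ tt) T (branch-else {p = p} {P} {Q} eq))
    (simulate Q _ _ (embeds-part R Q e k (λ s → inj₂ (inj₂ s)) nothing em (λ _ _ → refl)) r)
  simulate R@(while p P) e k {T} em (run-stop eq) =
    obey R e k em (inj₁ tt) T (while-stop {p = p} {P} eq)
  simulate R@(while p P) e k {T} em (run-again eq r r′) = reach-trans machine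
    (obey R e k em (inj₁ tt) T (while-again {p = p} {P} eq))
    (reach-trans machine
      (simulate P _ _ (embeds-part R P e k inj₂ (just (inj₁ tt)) em (λ _ _ → refl)) r)
      (simulate R e k em r′))
  simulate P e k em (slack t≤u r) = reach-slack machine t≤u (simulate P e k em r)

  initConfig-conf : ∀ bs → initConfig machine bs ≡ conf (stateIndex (entry main)) (inputTape bs)
  initConfig-conf []       = refl
  initConfig-conf (b ∷ bs) = cong (config _ [] (bitSym b)) (lemma bs)
    where
    lemma : ∀ bs → map bitSym bs ≡ map Sy.to (map bit bs)
    lemma []       = refl
    lemma (b ∷ bs) = cong (bitSym b ∷_) (lemma bs)

  readBits-map : ∀ xs → readBits (map Sy.to xs) ≡ readSymbols xs
  readBits-map []               = refl
  readBits-map (□ ∷ xs)         = refl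
  readBits-map (bit false ∷ xs) = cong (false ∷_) (readBits-map xs)
  readBits-map (bit true ∷ xs)  = cong (true ∷_) (readBits-map xs)
  readBits-map (aux _ ∷ xs)     = refl

  computes : ∀ {bs ls h rs t u} → main ⊢ inputTape bs ⇓[ t ] tape ls h rs → t ≤ u →
             Σ (Config machine) λ c → (runWithin machine u (initConfig machine bs) ≡ just c)
                                      × (output c ≡ readSymbols (h ∷ rs))
  computes {bs} {ls} {h} {rs} r t≤u = conf zero (tape ls h rs) ,
    subst (λ c → runWithin machine _ c ≡ just (conf zero (tape ls h rs))) (sym (initConfig-conf bs))
      (runWithin-reach machine (reach-slack machine t≤u (simulate main stateIndex zero embeds-main r)) refl)
    , readBits-map (h ∷ rs)

-- Sweeps and their cost

module _ {Aux : Set} where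

  private
    Γ = Symbol Aux

  flipMove : Move → Move
  flipMove left  = right
  flipMove right = left
  flipMove stay  = stay

  -- Sweeps are written for the right side only. The counter lies to the left of home and is served
  -- by their reflections.
  mirror : Program {Γ} → Program {Γ}
  mirror (act f)        = act (λ x → map₂ flipMove (f x))
  mirror (P » Q)        = mirror P » mirror Q
  mirror (branch p P Q) = branch p (mirror P) (mirror Q)
  mirror (while p P)    = while p (mirror P)

  mirrorTape : Tape Γ → Tape Γ
  mirrorTape (tape ls h rs) = tape rs h ls

  move-mirror : ∀ T a → move (mirrorTape T) (map₂ flipMove a) ≡ mirrorTape (move T a)
  move-mirror (tape []      _ _)       (x , left)  = refl
  move-mirror (tape (_ ∷ _) _ _)       (x , left)  = refl
  move-mirror (tape _       _ [])      (x , right) = refl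
  move-mirror (tape _       _ (_ ∷ _)) (x , right) = refl
  move-mirror (tape _       _ _)       (x , stay)  = refl

  run-mirror : ∀ {P T t U} → P ⊢ T ⇓[ t ] U → mirror P ⊢ mirrorTape T ⇓[ t ] mirrorTape U
  run-mirror {act f} {T} run-act = subst (_ ⊢ _ ⇓[ 1 ]_) (move-mirror T _) run-act
  run-mirror (run-» r r′)        = run-» (run-mirror r) (run-mirror r′)
  run-mirror (run-then eq r)     = run-then eq (run-mirror r)
  run-mirror (run-else eq r)     = run-else eq (run-mirror r)
  run-mirror (run-stop eq)       = run-stop eq
  run-mirror (run-again eq r r′) = run-again eq (run-mirror r) (run-mirror r′)
  run-mirror (slack t≤u r)       = slack t≤u (run-mirror r)

  cellCount : Tape Γ → ℕ
  cellCount (tape ls _ rs) = length ls + length rs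

  -- Each cell costs a loop test and a move on the way out, and again on the way back. The 6 are the
  -- first move, the two failing loop tests, the branch, the turn and the write at home.
  sweepTime : ℕ → ℕ
  sweepTime B = 6 + 4 * B

  -- A sweep is a walk over the tape and back. It lengthens the tape by at most one cell, so that
  -- S sweeps cost at most S * sweepTime (S + cellCount T) steps.
  record Exec (P : Program {Γ}) (T : Tape Γ) (S : ℕ) (U : Tape Γ) : Set where
    constructor exec
    field
      time   : ∀ B → S + cellCount T ≤ B → P ⊢ T ⇓[ S * sweepTime B ] U
      growth : cellCount U ≤ S + cellCount T
  open Exec

  -- The first execution may have lengthened the tape by S cells, but no more, so the joint budget
  -- still covers the second one. This lets both be charged with the same B.
  room : ∀ {P T S U} S′ → Exec P T S U → S′ + cellCount U ≤ S + S′ + cellCount T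
  room {T = T} {S} {U} S′ e = begin
    S′ + cellCount U       ≤⟨ +-monoʳ-≤ S′ (growth e) ⟩
    S′ + (S + cellCount T) ≡⟨ +-assoc S′ S _ ⟨
    S′ + S + cellCount T   ≡⟨ cong (_+ cellCount T) (+-comm S′ S) ⟩
    S + S′ + cellCount T   ∎
    where open ≤-Reasoning

  exec-» : ∀ {P Q T U V S S′} → Exec P T S U → Exec Q U S′ V → Exec (P » Q) T (S + S′) V
  exec-» {T = T} {S = S} {S′} e e′ = exec
    (λ B le → slack (≤-reflexive (sym (*-distribʳ-+ (sweepTime B) S S′)))
      (run-» (time e B (≤-trans (+-monoˡ-≤ (cellCount T) (m≤m+n S S′)) le))
             (time e′ B (≤-trans (room S′ e) le))))
    (≤-trans (growth e′) (room S′ e))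

  exec-slack : ∀ {P T U S S′} → S ≤ S′ → Exec P T S U → Exec P T S′ U
  exec-slack {T = T} S≤S′ (exec run gr) = exec
    (λ B le → slack (*-monoˡ-≤ (sweepTime B) S≤S′) (run B (≤-trans (+-monoˡ-≤ (cellCount T) S≤S′) le)))
    (≤-trans gr (+-monoˡ-≤ (cellCount T) S≤S′))

  exec-then : ∀ {p P Q T U S} → p (Tape.head T) ≡ true → Exec P T S U → Exec (branch p P Q) T (suc S) U
  exec-then eq (exec run gr) = exec
    (λ B le → slack (s≤s (m≤n+m _ _)) (run-then eq (run B (≤-trans (n≤1+n _) le)))) (m≤n⇒m≤1+n gr)

  exec-else : ∀ {p P Q T U S} → p (Tape.head T) ≡ false → Exec Q T S U → Exec (branch p P Q) T (suc S) U
  exec-else eq (exec run gr) = exec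
    (λ B le → slack (s≤s (m≤n+m _ _)) (run-else eq (run B (≤-trans (n≤1+n _) le)))) (m≤n⇒m≤1+n gr)

  exec-stop : ∀ {p P T} → p (Tape.head T) ≡ false → Exec (while p P) T 1 T
  exec-stop eq = exec (λ B _ → slack (s≤s z≤n) (run-stop eq)) (n≤1+n _)

  exec-again : ∀ {p P T U V S S′} → p (Tape.head T) ≡ true → Exec P T S U →
               Exec (while p P) U S′ V → Exec (while p P) T (suc (S + S′)) V
  exec-again {T = T} {S = S} {S′} eq e e′ = exec
    (λ B le → slack (+-mono-≤ {1} (s≤s z≤n) (≤-reflexive (sym (*-distribʳ-+ (sweepTime B) S S′))))
      (run-again eq (time e B (≤-trans (+-monoˡ-≤ (cellCount T) (≤-trans (m≤m+n S S′) (n≤1+n _))) le))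
                    (time e′ B (≤-trans (m≤n⇒m≤1+n (room S′ e)) le))))
    (m≤n⇒m≤1+n (≤-trans (growth e′) (room S′ e)))

  exec-stay : ∀ {f : Γ → Γ} {ls h rs} → Exec (act (λ x → f x , stay)) (tape ls h rs) 1 (tape ls (f h) rs)
  exec-stay = exec (λ B _ → slack (s≤s z≤n) run-act) (n≤1+n _)

  exec-mirror : ∀ {P T S U} → Exec P T S U → Exec (mirror P) (mirrorTape T) S (mirrorTape U)
  exec-mirror {T = T} {S} {U} (exec run gr) = exec
    (λ B le → run-mirror (run B (subst (λ z → S + z ≤ B) (cellCount-mirror T) le)))
    (subst₂ (λ x y → x ≤ S + y) (sym (cellCount-mirror U)) (sym (cellCount-mirror T)) gr)
    where
    cellCount-mirror : ∀ T → cellCount (mirrorTape T) ≡ cellCount T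
    cellCount-mirror (tape ls _ rs) = +-comm (length rs) (length ls)

  -- Beyond the list lies blank tape, and a walk that runs off the end turns one blank position into
  -- a cell. This is the source of the growth by one and of the varying number of trailing blanks in
  -- all later lemmas.
  swept : (Γ → Bool) → (Γ → Γ) → (Γ → Γ) → List Γ → List Γ
  swept p m f []       = f □ ∷ []
  swept p m f (x ∷ xs) = if p x then m x ∷ swept p m f xs else f x ∷ xs

  stop : (Γ → Bool) → List Γ → Γ
  stop p []       = □
  stop p (x ∷ xs) = if p x then stop p xs else x

  length-swept : ∀ p m f xs → length (swept p m f xs) ≤ suc (length xs)
  length-swept p m f [] = ≤-refl
  length-swept p m f (x ∷ xs) with p x
  ... | true  = s≤s (length-swept p m f xs)
  ... | false = n≤1+n _

  module Sweep (isHome : Γ → Bool) where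

    Plain : Γ → Set
    Plain x = isHome x ≡ false

    return : (Γ → Γ) → (Γ → Γ) → Program
    return f u = act (λ x → f x , left) » while (λ x → not (isHome x)) (act (λ x → x , left)) » act (λ x → u x , stay)

    sweep : (p : Γ → Bool) (m f : Γ → Γ) (q : Γ → Bool) (u : Bool → Γ → Γ) → Program
    sweep p m f q u = act (λ x → x , right) » while p (act (λ x → m x , right)) »
                      branch q (return f (u true)) (return f (u false))

    focus : List Γ → List Γ → Tape Γ
    focus ls []       = tape ls □ []
    focus ls (x ∷ rs) = tape ls x rs

    move-right : ∀ ls h rs x → move (tape ls h rs) (x , right) ≡ focus (x ∷ ls) rs
    move-right ls h []       x = refl
    move-right ls h (_ ∷ rs) x = refl

    goRight : ∀ {f : Γ → Γ} ls h rs → act (λ x → f x , right) ⊢ tape ls h rs ⇓[ 1 ] focus (f h ∷ ls) rs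
    goRight ls h rs = subst (_ ⊢ _ ⇓[ 1 ]_) (move-right ls h rs _) run-act

    module _ {p : Γ → Bool} {m f : Γ → Γ} (p-□ : p □ ≡ false)
             (m-plain : ∀ x → Plain x → Plain (m x)) where

      -- The visited cells pile up in reverse on the left, and `ʳ++` lays them back as the walk home
      -- does. The last component anticipates `f`, which is applied only when the head turns.
      scan : ∀ ls rs → All Plain rs → ∃₂ λ pile rest →
             (while p (act (λ x → m x , right)) ⊢ focus ls rs ⇓[ suc (2 * length rs) ]
                tape (pile ++ ls) (stop p rs) rest) ×
             All Plain pile × (length pile ≤ length rs) ×
             (pile ʳ++ (f (stop p rs) ∷ rest) ≡ swept p m f rs)
      scan ls [] [] = [] , [] , run-stop p-□ , [] , z≤n , refl
      scan ls (x ∷ rs) (px ∷ plain) with p x in eq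
      ... | false = [] , rs , slack (s≤s z≤n) (run-stop eq) , [] , z≤n , refl
      ... | true with scan (m x ∷ ls) rs plain
      ... | pile , rest , run , pp , le , back = pile ∷ʳ m x , rest ,
        subst (λ z → _ ⊢ _ ⇓[ _ ] tape z (stop p rs) rest) (sym (∷ʳ-++ pile (m x) ls))
          (slack (≤-reflexive (cong suc (sym (*-suc 2 (length rs)))))
            (run-again eq (goRight ls x rs) run)) ,
        All.∷ʳ⁺ pp (m-plain x px) ,
        subst (_≤ suc (length rs)) (trans (+-comm 1 (length pile)) (sym (length-++ pile))) (s≤s le) ,
        trans (++-ʳ++ pile) (cong (m x ∷_) back)

    -- The position one step to the left of the turning point: on the nearest visited cell or, if
    -- there is none, already at home.
    landed : List Γ → List Γ → Γ → List Γ → Tape Γ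
    landed []         ls h rest = tape ls h rest
    landed (y ∷ pile) ls h rest = tape (pile ++ h ∷ ls) y rest

    move-left : ∀ pile ls h y rest {x} → move (tape (pile ++ h ∷ ls) y rest) (x , left) ≡ landed pile ls h (x ∷ rest)
    move-left []      ls h y rest = refl
    move-left (_ ∷ _) ls h y rest = refl

    walkLeft : ∀ pile ls h rest → isHome h ≡ true → All Plain pile →
               while (λ x → not (isHome x)) (act (λ x → x , left)) ⊢ landed pile ls h rest
                 ⇓[ suc (2 * length pile) ] tape ls h (pile ʳ++ rest)
    walkLeft []         ls h rest hh []       = run-stop (cong not hh)
    walkLeft (y ∷ pile) ls h rest hh (py ∷ pp) =
      slack (≤-reflexive (cong suc (sym (*-suc 2 (length pile)))))
        (run-again (cong not py) (subst (_ ⊢ _ ⇓[ 1 ]_) (move-left pile ls h y rest) run-act)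
          (walkLeft pile ls h (y ∷ rest) hh pp))

    goBack : ∀ {f u pile ls h x rest} → isHome h ≡ true → All Plain pile →
             return f u ⊢ tape (pile ++ h ∷ ls) x rest
               ⇓[ 1 + (suc (2 * length pile) + 1) ] tape ls (u h) (pile ʳ++ (f x ∷ rest))
    goBack {pile = pile} {ls} {h} {x} {rest} hh pp =
      run-» (subst (_ ⊢ _ ⇓[ 1 ]_) (move-left pile ls h x rest) run-act)
        (run-» (walkLeft pile ls h _ hh pp) run-act)

    exec-sweep : ∀ {p m f q u ls h rs} → p □ ≡ false → (∀ x → Plain x → Plain (m x)) →
                 isHome h ≡ true → All Plain rs →
                 Exec (sweep p m f q u) (tape ls h rs) 1 (tape ls (u (q (stop p rs)) h) (swept p m f rs))
    exec-sweep {p} {m} {f} {q} {u} {ls} {h} {rs} p-□ m-plain hh plain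
      with scan {p} {m} {f} p-□ m-plain (h ∷ ls) rs plain
    ... | pile , rest , run , pp , le , back = exec
      (λ B room → slack (bound B room) (run-» (goRight ls h rs) (run-» run turn)))
      (≤-trans (+-monoʳ-≤ (length ls) (length-swept p m f rs)) (≤-reflexive (+-suc (length ls) (length rs))))
      where
      turn : branch q (return f (u true)) (return f (u false)) ⊢ tape (pile ++ h ∷ ls) (stop p rs) rest
               ⇓[ suc (1 + (suc (2 * length pile) + 1)) ] tape ls (u (q (stop p rs)) h) (swept p m f rs)
      turn with q (stop p rs) in eq
      ... | true  = run-then eq (subst (λ z → _ ⊢ _ ⇓[ _ ] tape ls (u true h) z) back (goBack hh pp))
      ... | false = run-else eq (subst (λ z → _ ⊢ _ ⇓[ _ ] tape ls (u false h) z) back (goBack hh pp))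
      bound : ∀ B → 1 + (length ls + length rs) ≤ B →
              1 + (suc (2 * length rs) + suc (1 + (suc (2 * length pile) + 1))) ≤ 1 * sweepTime B
      bound B room = begin
        1 + (suc (2 * length rs) + suc (1 + (suc (2 * length pile) + 1)))
          ≤⟨ s≤s (s≤s (+-monoʳ-≤ (2 * length rs) (s≤s (s≤s (s≤s (+-monoˡ-≤ 1 (*-monoʳ-≤ 2 le))))))) ⟩
        1 + (suc (2 * length rs) + suc (1 + (suc (2 * length rs) + 1)))
          ≡⟨ arith (length rs) ⟩
        6 + 4 * length rs
          ≤⟨ +-monoʳ-≤ 6 (*-monoʳ-≤ 4 (≤-trans (m≤n+m _ (suc (length ls))) room)) ⟩
        6 + 4 * B
          ≡⟨ *-identityˡ (6 + 4 * B) ⟨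
        1 * (6 + 4 * B) ∎
        where
        open ≤-Reasoning
        arith : ∀ r → 1 + (suc (2 * r) + suc (1 + (suc (2 * r) + 1))) ≡ 6 + 4 * r
        arith = solve-∀

-- The tape of a loop program

Registers : Set
Registers = ℕ → ℕ

-- Recursion on the index, rather than an equality test, matches the recursion of `marks` and
-- `setMark`.
update : ℕ → ℕ → Registers → Registers
update zero    v ρ zero    = v
update zero    v ρ (suc i) = ρ (suc i)
update (suc r) v ρ zero    = ρ zero
update (suc r) v ρ (suc i) = update r v (λ j → ρ (suc j)) i

update-same : ∀ r v ρ → update r v ρ r ≡ v
update-same zero    v ρ = refl
update-same (suc r) v ρ = update-same r v _

update-other : ∀ r v ρ i → i ≢ r → update r v ρ i ≡ ρ i
update-other zero    v ρ zero    ne = contradiction refl ne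
update-other zero    v ρ (suc i) ne = refl
update-other (suc r) v ρ zero    ne = refl
update-other (suc r) v ρ (suc i) ne = update-other r v _ i (ne ∘ cong suc)

update-id : ∀ r ρ i → update r (ρ r) ρ i ≡ ρ i
update-id zero    ρ zero    = refl
update-id zero    ρ (suc i) = refl
update-id (suc r) ρ zero    = refl
update-id (suc r) ρ (suc i) = update-id r _ i

-- One cell further along the input every register appears smaller by one, so an update has to pass
-- through `pred`.
pred-update : ∀ r v ρ i → pred (update r v ρ i) ≡ update r (pred v) (pred ∘ ρ) i
pred-update zero    v ρ zero    = refl
pred-update zero    v ρ (suc i) = refl
pred-update (suc r) v ρ zero    = refl
pred-update (suc r) v ρ (suc i) = pred-update r v _ i

positive : ℕ → Bool
positive zero    = false
positive (suc _) = true

mark : ∀ {K} → ℕ → Vec Bool K → Bool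
mark _       []      = false
mark zero    (b ∷ _) = b
mark (suc r) (_ ∷ v) = mark r v

setMark : ∀ {K} → ℕ → Bool → Vec Bool K → Vec Bool K
setMark _       b []      = []
setMark zero    b (_ ∷ v) = b ∷ v
setMark (suc r) b (c ∷ v) = c ∷ setMark r b v

marks : ∀ K → Registers → Vec Bool K
marks zero    ρ = []
marks (suc K) ρ = positive (ρ 0) ∷ marks K (ρ ∘ suc)

marks-cong : ∀ K {ρ ρ′} → (∀ i → ρ i ≡ ρ′ i) → marks K ρ ≡ marks K ρ′
marks-cong zero    eq = refl
marks-cong (suc K) eq = cong₂ _∷_ (cong positive (eq 0)) (marks-cong K (eq ∘ suc))

mark-marks : ∀ {K r} ρ → r < K → mark r (marks K ρ) ≡ positive (ρ r)
mark-marks {suc K} {zero}  ρ r<K       = refl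
mark-marks {suc K} {suc r} ρ (s≤s r<K) = mark-marks (ρ ∘ suc) r<K

setMark-marks : ∀ K r v ρ → setMark r (positive v) (marks K ρ) ≡ marks K (update r v ρ)
setMark-marks zero    r       v ρ = refl
setMark-marks (suc K) zero    v ρ = refl
setMark-marks (suc K) (suc r) v ρ = cong (_ ∷_) (setMark-marks K r v (ρ ∘ suc))

-- Lowest digit first: the order in which a carry travels and also the order in which `encℕᵇ`
-- prints.
digits : ℕᵇ → List Bool
digits ℕᵇ.zero  = []
digits 2[1+ x ] = true ∷ digits x
digits 1+[2 x ] = false ∷ digits x

encDigits : List Bool → List Bool
encDigits []       = false ∷ []
encDigits (d ∷ ds) = true ∷ d ∷ encDigits ds

encDigits-digits : ∀ x → encDigits (digits x) ≡ encℕᵇ x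
encDigits-digits ℕᵇ.zero  = refl
encDigits-digits 2[1+ x ] = cong (λ z → true ∷ true ∷ z) (encDigits-digits x)
encDigits-digits 1+[2 x ] = cong (λ z → true ∷ false ∷ z) (encDigits-digits x)

length-digits-suc : ∀ x → length (digits (Bin.suc x)) ≤ suc (length (digits x))
length-digits-suc ℕᵇ.zero  = s≤s z≤n
length-digits-suc 2[1+ x ] = s≤s (length-digits-suc x)
length-digits-suc 1+[2 x ] = n≤1+n _

nth : ℕ → List Bool → Bool
nth _       []       = false
nth zero    (b ∷ _)  = b
nth (suc k) (_ ∷ bs) = nth k bs

-- The tape reads: binary counter (lowest digit next to home), home, input cells, output bits.
-- Register r has value v if precisely the first v input cells carry its mark.
module Alphabet (K : ℕ) where

  Aux : Set
  Aux = (Bool × Bool) ⊎ (Bool × Bool) ⊎ (Bool × Vec Bool K)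

  finite-Aux : Finite Aux
  finite-Aux = finite-⊎ (finite-× finite-Bool finite-Bool)
    (finite-⊎ (finite-× finite-Bool finite-Bool) (finite-× finite-Bool (finite-Vec finite-Bool K)))

  Γ : Set
  Γ = Symbol Aux

  -- home flag go; digit value seen, where the value true is the digit 2; input bit marks
  pattern home f g  = aux (inj₁ (f , g))
  pattern digit d s = aux (inj₂ (inj₁ (d , s)))
  pattern input b v = aux (inj₂ (inj₂ (b , v)))

  isHome : Γ → Bool
  isHome (home _ _) = true
  isHome _          = false

  open Sweep isHome public

  getFlag getGo : Γ → Bool
  getFlag (home f _) = f
  getFlag _          = false
  getGo (home _ g) = g
  getGo _          = false

  setFlag setGo : Bool → Γ → Γ
  setFlag f (home _ g) = home f g
  setFlag _ x          = x
  setGo g (home f _) = home f g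
  setGo _ x          = x

  onInput : (Bool → Vec Bool K → Bool) → Γ → Bool
  onInput t (input b v) = t b v
  onInput t _           = false

  mapMarks : (Vec Bool K → Vec Bool K) → Γ → Γ
  mapMarks μ (input b v) = input b (μ v)
  mapMarks μ x           = x

  mapMarks-plain : ∀ μ x → Plain x → Plain (mapMarks μ x)
  mapMarks-plain μ □           _ = refl
  mapMarks-plain μ (bit _)     _ = refl
  mapMarks-plain μ (digit _ _) _ = refl
  mapMarks-plain μ (input _ _) _ = refl

  cells : Registers → List Bool → List Γ
  cells ρ []       = []
  cells ρ (b ∷ bs) = input b (marks K ρ) ∷ cells (pred ∘ ρ) bs

  blanks : ℕ → List Γ
  blanks j = replicate j □

  written : List Bool → ℕ → List Γ
  written o j = map bit o ++ blanks j

  rightCells : Registers → List Bool → List Bool → ℕ → List Γ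
  rightCells ρ bs o j = cells ρ bs ++ written o j

  cells-cong : ∀ bs {ρ ρ′} → (∀ i → ρ i ≡ ρ′ i) → cells ρ bs ≡ cells ρ′ bs
  cells-cong []       eq = refl
  cells-cong (b ∷ bs) eq = cong₂ _∷_ (cong (input b) (marks-cong K eq)) (cells-cong bs (cong pred ∘ eq))

  plain-blanks : ∀ j → All Plain (blanks j)
  plain-blanks zero    = []
  plain-blanks (suc j) = refl ∷ plain-blanks j

  plain-written : ∀ o j → All Plain (written o j)
  plain-written []      j = plain-blanks j
  plain-written (_ ∷ o) j = refl ∷ plain-written o j

  plain-right : ∀ ρ bs o j → All Plain (rightCells ρ bs o j)
  plain-right ρ []       o j = plain-written o j
  plain-right ρ (_ ∷ bs) o j = refl ∷ plain-right _ bs o j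

  -- the sweep may append a blank when it runs to the end of the tape
  swept-written : ∀ t {m} μ o j → ∃ λ j′ → swept (onInput t) m (mapMarks μ) (written o j) ≡ written o j′
  swept-written t μ []      zero    = 1 , refl
  swept-written t μ []      (suc j) = suc j , refl
  swept-written t μ (_ ∷ o) j       = j , refl

  stop-written : ∀ t q o j → onInput q (stop (onInput t) (written o j)) ≡ false
  stop-written t q []      zero    = refl
  stop-written t q []      (suc j) = refl
  stop-written t q (_ ∷ o) j       = refl

  marked : ℕ → Γ → Bool
  marked r = onInput (λ _ v → mark r v)

  swept-look : ∀ t ρ bs o j → ∃ λ j′ → swept (onInput t) id (mapMarks id) (rightCells ρ bs o j) ≡ rightCells ρ bs o j′
  swept-look t ρ []       o j = swept-written t id o j
  swept-look t ρ (b ∷ bs) o j with t b (marks K ρ) | swept-look t (pred ∘ ρ) bs o j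
  ... | false | _       = j , refl
  ... | true  | j′ , eq = j′ , cong (_ ∷_) eq

  -- The walk marks the first cell that lacks the mark. A register beyond the input length shows as
  -- marks on every cell, and a further increment leaves the input cells alone, so `ρ r` needs no
  -- upper bound.
  swept-inc : ∀ {r} → r < K → ∀ ρ bs o j → ∃ λ j′ →
              swept (marked r) id (mapMarks (setMark r true)) (rightCells ρ bs o j) ≡
              rightCells (update r (suc (ρ r)) ρ) bs o j′
  swept-inc {r} r<K ρ [] o j = swept-written _ (setMark r true) o j
  swept-inc {r} r<K ρ (b ∷ bs) o j rewrite mark-marks ρ r<K with ρ r in eq
  ... | zero  = j , cong₂ _∷_ (cong (input b) (setMark-marks K r 1 ρ)) (cong (_++ written o j)
                  (cells-cong bs λ i → sym (trans (pred-update r 1 ρ i)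
                    (subst (λ z → update r z (pred ∘ ρ) i ≡ pred (ρ i)) (cong pred eq) (update-id r (pred ∘ ρ) i)))))
  ... | suc v with swept-inc r<K (pred ∘ ρ) bs o j
  ... | j′ , ih = j′ , cong₂ _∷_
    (cong (input b) (trans
      (marks-cong K λ i → sym (trans (cong (λ z → update r z ρ i) (sym eq)) (update-id r ρ i)))
      (trans (sym (setMark-marks K r (suc v) ρ)) (setMark-marks K r (suc (suc v)) ρ))))
    (trans ih (cong (_++ written o j′) (cells-cong bs λ i →
      sym (trans (pred-update r (suc (suc v)) ρ i)
        (cong (λ z → update r (suc (pred z)) (pred ∘ ρ) i) (sym eq))))))

  swept-clear : ∀ r ρ bs o j → ∃ λ j′ →
                swept (onInput (λ _ _ → true)) (mapMarks (setMark r false)) (mapMarks id) (rightCells ρ bs o j) ≡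
                rightCells (update r 0 ρ) bs o j′
  swept-clear r ρ []       o j = swept-written _ id o j
  swept-clear r ρ (b ∷ bs) o j with swept-clear r (pred ∘ ρ) bs o j
  ... | j′ , ih = j′ , cong₂ _∷_ (cong (input b) (setMark-marks K r 0 ρ))
    (trans ih (cong (_++ written o j′) (cells-cong bs λ i → sym (pred-update r 0 ρ i))))

  -- The first cell without the mark is cell number `ρ r`. Past the input the walk ends on an output
  -- bit or a blank, and the test answers false like `nth`.
  stop-read : ∀ {r} → r < K → ∀ ρ bs o j →
              onInput (λ b _ → b) (stop (marked r) (rightCells ρ bs o j)) ≡ nth (ρ r) bs
  stop-read r<K ρ [] o j = stop-written _ _ o j
  stop-read {r} r<K ρ (b ∷ bs) o j rewrite mark-marks ρ r<K with ρ r in eq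
  ... | zero  = refl
  ... | suc v = trans (stop-read r<K (pred ∘ ρ) bs o j) (cong (λ z → nth (pred z) bs) eq)

  notBelow : ℕ → ℕ → Bool → Vec Bool K → Bool
  notBelow r s _ v = mark r v ∨ not (mark s v)

  -- The walk ends on an input cell exactly if some cell carries the mark of s but not that of r.
  -- This decides the comparison only while s has not overrun the input, hence the bound on `ρ s`.
  stop-less : ∀ {r s} → r < K → s < K → ∀ ρ bs o j → ρ s ≤ length bs →
              onInput (λ _ _ → true) (stop (onInput (notBelow r s)) (rightCells ρ bs o j)) ≡ (ρ r <ᵇ ρ s)
  stop-less {r} {s} r<K s<K ρ [] o j le rewrite n≤0⇒n≡0 le = stop-written _ _ o j
  stop-less {r} {s} r<K s<K ρ (b ∷ bs) o j le rewrite mark-marks ρ r<K | mark-marks ρ s<K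
    with ρ r in eqr | ρ s in eqs | stop-less r<K s<K (pred ∘ ρ) bs o j (pred-mono-≤ le)
  ... | zero  | zero  | ih = ih
  ... | zero  | suc _ | ih = refl
  ... | suc _ | zero  | ih = ih
  ... | suc _ | suc _ | ih = ih

  notBlank : Γ → Bool
  notBlank □ = false
  notBlank _ = true

  swept-emit : ∀ b ρ bs o j → ∃ λ j′ →
               swept notBlank id (const (bit b)) (rightCells ρ bs o j) ≡ rightCells ρ bs (o ∷ʳ b) j′
  swept-emit b ρ [] []      zero    = 0 , refl
  swept-emit b ρ [] []      (suc j) = j , refl
  swept-emit b ρ [] (c ∷ o) j with swept-emit b ρ [] o j
  ... | j′ , ih = j′ , cong (bit c ∷_) ih
  swept-emit b ρ (c ∷ bs) o j with swept-emit b (pred ∘ ρ) bs o j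
  ... | j′ , ih = j′ , cong (_ ∷_) ih

  isSeen isUnseen isDigit isTwo : Γ → Bool
  isSeen (digit _ s) = s
  isSeen _           = false
  isUnseen (digit _ s) = not s
  isUnseen _           = false
  isDigit (digit _ _) = true
  isDigit _           = false
  isTwo (digit d _) = d
  isTwo _           = false

  bump see unsee : Γ → Γ
  bump □           = digit false false
  bump (digit _ s) = digit true s
  bump x           = x
  see (digit d _) = digit d true
  see x           = x
  unsee (digit d _) = digit d false
  unsee x           = x

  unsee-plain : ∀ x → Plain x → Plain (unsee x)
  unsee-plain □           _ = refl
  unsee-plain (bit _)     _ = refl
  unsee-plain (digit _ _) _ = refl
  unsee-plain (input _ _) _ = refl

  seen unseen : List Bool → List Γ
  seen   = map (λ d → digit d true)
  unseen = map (λ d → digit d false)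

  counterCells : ℕᵇ → ℕ → List Γ
  counterCells x j = unseen (digits x) ++ blanks j

  plain-unseen : ∀ ds j → All Plain (unseen ds ++ blanks j)
  plain-unseen []       j = plain-blanks j
  plain-unseen (_ ∷ ds) j = refl ∷ plain-unseen ds j

  plain-partly : ∀ ds es j → All Plain (seen ds ++ unseen es ++ blanks j)
  plain-partly []       es j = plain-unseen es j
  plain-partly (_ ∷ ds) es j = refl ∷ plain-partly ds es j

  -- Successor in bijective base 2: the initial run of 2s becomes 1s, and the carry either raises
  -- the next digit from 1 to 2 or starts a new digit 1.
  swept-count : ∀ x j → ∃ λ j′ →
                swept isTwo (const (digit false false)) bump (counterCells x j) ≡ counterCells (Bin.suc x) j′
  swept-count ℕᵇ.zero  zero    = 0 , refl
  swept-count ℕᵇ.zero  (suc j) = j , refl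
  swept-count 1+[2 x ] j       = j , refl
  swept-count 2[1+ x ] j with swept-count x j
  ... | j′ , ih = j′ , cong (_ ∷_) ih

  swept-blanks : ∀ {p m f} → p □ ≡ false → f □ ≡ □ → ∀ j → ∃ λ j′ → swept p m f (blanks j) ≡ blanks j′
  swept-blanks p-□ f-□ zero = 1 , cong (_∷ []) f-□
  swept-blanks p-□ f-□ (suc j) rewrite p-□ = suc j , cong (_∷ blanks j) f-□

  swept-zero : ∀ x j → ∃ λ j′ → swept isDigit (const □) id (counterCells x j) ≡ counterCells ℕᵇ.zero j′
  swept-zero x j = go (digits x)
    where
    go : ∀ ds → ∃ λ j′ → swept isDigit (const □) id (unseen ds ++ blanks j) ≡ blanks j′
    go [] = swept-blanks refl refl j
    go (d ∷ ds) with go ds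
    ... | j′ , ih = suc j′ , cong (□ ∷_) ih

  swept-seen : ∀ f ds ys → swept isSeen id f (seen ds ++ ys) ≡ seen ds ++ swept isSeen id f ys
  swept-seen f []       ys = refl
  swept-seen f (d ∷ ds) ys = cong (_ ∷_) (swept-seen f ds ys)

  stop-seen : ∀ ds ys → stop isSeen (seen ds ++ ys) ≡ stop isSeen ys
  stop-seen []       ys = refl
  stop-seen (d ∷ ds) ys = stop-seen ds ys

  swept-unsee : ∀ ds j → ∃ λ j′ → swept isDigit unsee id (seen ds ++ blanks j) ≡ unseen ds ++ blanks j′
  swept-unsee []       j = swept-blanks refl refl j
  swept-unsee (d ∷ ds) j with swept-unsee ds j
  ... | j′ , ih = j′ , cong (_ ∷_) ih

  -- Elementary operations as sweeps

  record Rule : Set where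
    constructor rule
    field
      p   : Γ → Bool
      m f : Γ → Γ
      q   : Γ → Bool
      u   : Bool → Γ → Γ

  sweepRight sweepLeft : Rule → Program
  sweepRight (rule p m f q u) = sweep p m f q u
  sweepLeft R = mirror (sweepRight R)

  module _ (R : Rule) {ls rs : List Γ} {h : Γ} {b : Bool} where

    open Rule R

    exec-right : ∀ {rs′} → p □ ≡ false → (∀ x → Plain x → Plain (m x)) → isHome h ≡ true →
                 All Plain rs → swept p m f rs ≡ rs′ → q (stop p rs) ≡ b →
                 Exec (sweepRight R) (tape ls h rs) 1 (tape ls (u b h) rs′)
    exec-right p-□ m-plain hh plain refl refl = exec-sweep {p} {m} {f} {q} {u} p-□ m-plain hh plain

    exec-left : ∀ {ls′} → p □ ≡ false → (∀ x → Plain x → Plain (m x)) → isHome h ≡ true →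
                All Plain ls → swept p m f ls ≡ ls′ → q (stop p ls) ≡ b →
                Exec (sweepLeft R) (tape ls h rs) 1 (tape ls′ (u b h) rs)
    exec-left p-□ m-plain hh plain refl refl =
      exec-mirror (exec-sweep {p} {m} {f} {q} {u} p-□ m-plain hh plain)

  same : Bool → Γ → Γ
  same _ x = x

  nowhere : Γ → Bool
  nowhere _ = false

  incRule clearRule readRule : ℕ → Rule
  incRule r   = rule (marked r) id (mapMarks (setMark r true)) nowhere same
  clearRule r = rule (onInput (λ _ _ → true)) (mapMarks (setMark r false)) (mapMarks id) nowhere same
  readRule r  = rule (marked r) id (mapMarks id) (onInput (λ b _ → b)) setFlag

  lessRule : ℕ → ℕ → Rule
  lessRule r s = rule (onInput (notBelow r s)) id (mapMarks id) (onInput (λ _ _ → true)) setFlag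

  emitRule : Bool → Rule
  emitRule b = rule notBlank id (const (bit b)) nowhere same

  upRule zeroRule nextRule takeRule forgetRule : Rule
  upRule     = rule isTwo (const (digit false false)) bump nowhere same
  zeroRule   = rule isDigit (const □) id nowhere same
  nextRule   = rule isSeen id id isUnseen setGo
  takeRule   = rule isSeen id see isTwo setFlag
  forgetRule = rule isDigit unsee id nowhere same

  put : (Γ → Γ) → Program
  put f = act (λ x → f x , stay)

  -- Counter and output lie on opposite sides of home, so a digit travels in the flag. `nextRule`
  -- records in `go` whether an unprinted digit is left, and `takeRule` marks it as seen and copies
  -- its value. The bit `true` in front is the continuation bit of `encℕᵇ`.
  emitDigit : Program
  emitDigit = sweepLeft nextRule »
    branch getGo (sweepLeft takeRule »
                  sweepRight (emitRule true) » branch getFlag (sweepRight (emitRule true)) (sweepRight (emitRule false)))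
                 (put id)

  -- The single `false` is the terminator of `encℕᵇ`. Clearing the flag at the end makes its value
  -- independent of the digits that passed through it.
  emitCounter : Program
  emitCounter = put (setGo true) » while getGo emitDigit » sweepLeft forgetRule »
                sweepRight (emitRule false) » put (setFlag false)

  module _ (bs : List Bool) where

    exec-inc : ∀ {r} → r < K → ∀ ρ {ls f g} o j → ∃ λ j′ → Exec (sweepRight (incRule r))
      (tape ls (home f g) (rightCells ρ bs o j)) 1 (tape ls (home f g) (rightCells (update r (suc (ρ r)) ρ) bs o j′))
    exec-inc r<K ρ o j with swept-inc r<K ρ bs o j
    ... | j′ , eq = j′ , exec-right (incRule _) refl (λ _ p → p) refl (plain-right ρ bs o j) eq refl

    exec-clear : ∀ r ρ {ls f g} o j → ∃ λ j′ → Exec (sweepRight (clearRule r))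
      (tape ls (home f g) (rightCells ρ bs o j)) 1 (tape ls (home f g) (rightCells (update r 0 ρ) bs o j′))
    exec-clear r ρ o j with swept-clear r ρ bs o j
    ... | j′ , eq = j′ , exec-right (clearRule r) refl (mapMarks-plain _) refl (plain-right ρ bs o j) eq refl

    exec-read : ∀ {r} → r < K → ∀ ρ {ls f g} o j → ∃ λ j′ → Exec (sweepRight (readRule r))
      (tape ls (home f g) (rightCells ρ bs o j)) 1 (tape ls (home (nth (ρ r) bs) g) (rightCells ρ bs o j′))
    exec-read r<K ρ o j with swept-look _ ρ bs o j
    ... | j′ , eq = j′ , exec-right (readRule _) refl (λ _ p → p) refl (plain-right ρ bs o j) eq (stop-read r<K ρ bs o j)

    exec-less : ∀ {r s} → r < K → s < K → ∀ ρ → ρ s ≤ length bs → ∀ {ls f g} o j → ∃ λ j′ → Exec (sweepRight (lessRule r s))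
      (tape ls (home f g) (rightCells ρ bs o j)) 1 (tape ls (home (ρ r <ᵇ ρ s) g) (rightCells ρ bs o j′))
    exec-less r<K s<K ρ le o j with swept-look _ ρ bs o j
    ... | j′ , eq = j′ , exec-right (lessRule _ _) refl (λ _ p → p) refl (plain-right ρ bs o j) eq
      (stop-less r<K s<K ρ bs o j le)

    exec-emitBit : ∀ b ρ {ls f g} o j → ∃ λ j′ → Exec (sweepRight (emitRule b))
      (tape ls (home f g) (rightCells ρ bs o j)) 1 (tape ls (home f g) (rightCells ρ bs (o ∷ʳ b) j′))
    exec-emitBit b ρ o j with swept-emit b ρ bs o j
    ... | j′ , eq = j′ , exec-right (emitRule b) refl (λ _ p → p) refl (plain-right ρ bs o j) eq refl

    exec-countUp : ∀ x i {f g rs} → ∃ λ i′ → Exec (sweepLeft upRule)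
      (tape (counterCells x i) (home f g) rs) 1 (tape (counterCells (Bin.suc x) i′) (home f g) rs)
    exec-countUp x i with swept-count x i
    ... | i′ , eq = i′ , exec-left upRule refl (λ _ _ → refl) refl (plain-unseen (digits x) i) eq refl

    exec-countReset : ∀ x i {f g rs} → ∃ λ i′ → Exec (sweepLeft zeroRule)
      (tape (counterCells x i) (home f g) rs) 1 (tape (counterCells ℕᵇ.zero i′) (home f g) rs)
    exec-countReset x i with swept-zero x i
    ... | i′ , eq = i′ , exec-left zeroRule refl (λ _ _ → refl) refl (plain-unseen (digits x) i) eq refl

    -- Invariant: `ds` is printed and `es` is still to come. A digit costs 7: a loop test, two
    -- branches, two sweeps on each side. The last round costs 5: a loop test, one sweep, a branch,
    -- an idle step and the failing test.
    exec-digits : ∀ es ds ρ o i j f → ∃ λ f′ → ∃₂ λ i′ j′ → Exec (while getGo emitDigit)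
      (tape (seen ds ++ unseen es ++ blanks i) (home f true) (rightCells ρ bs o j))
      (5 + 7 * length es)
      (tape (seen (ds ++ es) ++ blanks i′) (home f′ false)
            (rightCells ρ bs (o ++ concatMap (λ d → true ∷ d ∷ []) es) j′))
    exec-digits [] ds ρ o i j f with swept-blanks {isSeen} {id} {id} refl refl i
    ... | i′ , eq = f , i′ , j ,
      exec-again refl (exec-» (exec-left nextRule refl (λ _ p → p) refl (plain-partly ds [] i)
          (trans (swept-seen id ds (blanks i)) (cong₂ (λ z w → seen z ++ w) (sym (++-identityʳ ds)) eq))
          (trans (cong isUnseen (stop-seen ds (blanks i))) (end i)))
        (exec-else refl (exec-stay {f = id}))) done
      where
      end : ∀ i → isUnseen (stop isSeen (blanks i)) ≡ false
      end zero    = refl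
      end (suc _) = refl
      done : ∀ {ls} → Exec (while getGo emitDigit) (tape ls (home f false) (rightCells ρ bs o j)) 1
                           (tape ls (home f false) (rightCells ρ bs (o ++ []) j))
      done rewrite ++-identityʳ o = exec-stop refl
    exec-digits (e ∷ es) ds ρ o i j f
      with exec-emitBit true ρ {seen ds ++ digit e true ∷ unseen es ++ blanks i} {e} {true} o j
    ... | j₁ , e₁ with second e j₁
      where
      second : ∀ e′ j₁ {ls} → ∃ λ j₂ → Exec (branch getFlag (sweepRight (emitRule true)) (sweepRight (emitRule false)))
        (tape ls (home e′ true) (rightCells ρ bs (o ∷ʳ true) j₁)) 2
        (tape ls (home e′ true) (rightCells ρ bs (o ∷ʳ true ∷ʳ e′) j₂))
      second true  j₁ with exec-emitBit true ρ (o ∷ʳ true) j₁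
      ... | j₂ , e₂ = j₂ , exec-then refl e₂
      second false j₁ with exec-emitBit false ρ (o ∷ʳ true) j₁
      ... | j₂ , e₂ = j₂ , exec-else refl e₂
    ... | j₂ , e₂ with exec-digits es (ds ∷ʳ e) ρ (o ∷ʳ true ∷ʳ e) i j₂ e
    ... | f′ , i′ , j′ , rest = f′ , i′ , j′ ,
      subst₂ (Exec (while getGo emitDigit)
                   (tape (seen ds ++ unseen (e ∷ es) ++ blanks i) (home f true) (rightCells ρ bs o j))) (arith (length es))
        (cong₂ (λ z w → tape (seen z ++ blanks i′) (home f′ false) (rightCells ρ bs w j′))
          (∷ʳ-++ ds e es)
          (trans (++-assoc (o ∷ʳ true) (e ∷ []) _) (++-assoc o (true ∷ []) _)))
        (exec-again refl
          (exec-» (exec-left nextRule refl (λ _ p → p) refl (plain-partly ds (e ∷ es) i)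
              (swept-seen id ds _) (cong isUnseen (stop-seen ds _)))
            (exec-then refl
              (exec-» (exec-left takeRule refl (λ _ p → p) refl (plain-partly ds (e ∷ es) i)
                  (swept-seen see ds _) (cong isTwo (stop-seen ds _)))
                (exec-» e₁ e₂))))
          (subst (λ z → Exec _ (tape z _ _) _ _) (marked-next) rest))
      where
      arith : ∀ n → suc (1 + suc (1 + (1 + 2)) + (5 + 7 * n)) ≡ 5 + 7 * suc n
      arith = solve-∀
      marked-next : seen (ds ∷ʳ e) ++ unseen es ++ blanks i ≡ seen ds ++ digit e true ∷ unseen es ++ blanks i
      marked-next = trans (cong (_++ (unseen es ++ blanks i)) (map-++ _ ds (e ∷ []))) (++-assoc (seen ds) _ _)

    exec-emitCounter : ∀ x ρ o i j {f} → ∃₂ λ i′ j′ → Exec emitCounter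
      (tape (counterCells x i) (home f false) (rightCells ρ bs o j)) (9 + 7 * length (digits x))
      (tape (counterCells x i′) (home false false) (rightCells ρ bs (o ++ encℕᵇ x) j′))
    exec-emitCounter x ρ o i j {f} with exec-digits (digits x) [] ρ o i j f
    ... | f′ , i₁ , j₁ , e₁ with swept-unsee (digits x) i₁
    ... | i₂ , eq with exec-emitBit false ρ {counterCells x i₂} {f′} {false}
                         (o ++ concatMap (λ d → true ∷ d ∷ []) (digits x)) j₁
    ... | j₂ , e₂ = i₂ , j₂ ,
      subst₂ (λ S w → Exec emitCounter
                 (tape (counterCells x i) (home f false) (rightCells ρ bs o j)) S
                 (tape (counterCells x i₂) (home false false) (rightCells ρ bs w j₂)))
        (arith (7 * length (digits x)))
        (trans (++-assoc o _ _) (cong (o ++_) (trans (sym (code (digits x))) (encDigits-digits x))))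
        (exec-» (exec-stay {f = setGo true}) (exec-» e₁ (exec-»
          (exec-left forgetRule refl unsee-plain refl
            (plain-seen (digits x)) eq refl)
          (exec-» e₂ (exec-stay {f = setFlag false})))))
      where
      arith : ∀ n → 1 + (5 + n + (1 + (1 + 1))) ≡ 9 + n
      arith = solve-∀
      plain-seen : ∀ ds → All Plain (seen ds ++ blanks i₁)
      plain-seen ds = plain-partly ds [] i₁
      code : ∀ ds → encDigits ds ≡ concatMap (λ d → true ∷ d ∷ []) ds ++ false ∷ []
      code []       = refl
      code (d ∷ ds) = cong (λ z → true ∷ d ∷ z) (code ds)

-- Loop programs

-- Code m: m loop variables in scope (de Bruijn), ranging over the universe
data Code : ℕ → Set where
  skip     : ∀ {m} → Code m
  _⨾_      : ∀ {m} → Code m → Code m → Code m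
  ifFlag   : ∀ {m} → Code m → Code m → Code m
  -- run the body for every element in turn, until it leaves the flag set
  search   : ∀ {m} → Code (suc m) → Code m
  flag≔    : ∀ {m} → Bool → Code m
  flip     : ∀ {m} → Code m
  less     : ∀ {m} → Fin m → Fin m → Code m
  rewind   : ∀ {m} → Code m
  advance  : ∀ {m} → Code m
  readBit  : ∀ {m} → Code m
  reset    : ∀ {m} → Code m
  tick     : ∀ {m} → Code m
  emit     : ∀ {m} → Code m

infixr 5 _⨾_

record Store : Set where
  constructor store
  field
    flag    : Bool
    pointer : ℕ
    count   : ℕ
    out     : List Bool
open Store

searchOver : {X : Set} → (X → Store → Store) → List X → Store → Store
searchOver F []       s = s
searchOver F (x ∷ xs) s = if flag (F x s) then F x s else searchOver F xs (F x s)

record Input : Set where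
  constructor ⟪_,_⟫
  field
    universe : ℕ
    tables   : List Bool

  bits : List Bool
  bits = replicate universe true ++ false ∷ tables

open Input

⟦_⟧ : ∀ {m} → Code m → (I : Input) → Vec (Fin (universe I)) m → Store → Store
⟦ skip ⟧       I env s = s
⟦ P ⨾ Q ⟧      I env s = ⟦ Q ⟧ I env (⟦ P ⟧ I env s)
⟦ ifFlag P Q ⟧ I env s = if flag s then ⟦ P ⟧ I env s else ⟦ Q ⟧ I env s
-- With the flag cleared first, a search through an empty universe fails.
⟦ search P ⟧   I env s = searchOver (λ d → ⟦ P ⟧ I (d ∷ env)) (allFin (universe I)) (record s { flag = false })
⟦ flag≔ b ⟧    I env s = record s { flag = b }
⟦ flip ⟧       I env s = record s { flag = not (flag s) }
⟦ less i j ⟧   I env s = record s { flag = toℕ (Vec.lookup env i) <ᵇ toℕ (Vec.lookup env j) }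
⟦ rewind ⟧     I env s = record s { pointer = 0 }
⟦ advance ⟧    I env s = record s { pointer = suc (pointer s) }
⟦ readBit ⟧    I env s = record s { flag = nth (pointer s) (bits I) }
⟦ reset ⟧      I env s = record s { count = 0 }
⟦ tick ⟧       I env s = record s { count = suc (count s) }
⟦ emit ⟧       I env s = record s { flag = false ; out = out s ++ encℕ (count s) }

-- N will be the input length, which bounds the universe. `emit` counts as one operation because the
-- price of an operation will allow for the digits of the counter.
ops : ∀ {m} → Code m → ℕ → ℕ
ops (P ⨾ Q)      N = ops P N + ops Q N
ops (ifFlag P Q) N = 1 + (ops P N + ops Q N)
ops (search P)   N = 1 + N * (1 + ops P N)
ops _            N = 1

-- number of registers: register 0 is the pointer, loop variables occupy the others
need : ∀ {m} → Code m → ℕ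
need (P ⨾ Q)        = need P ⊔ need Q
need (ifFlag P Q)   = need P ⊔ need Q
need (search {m} P) = suc (suc m) ⊔ need P
need _              = 0

-- De Bruijn levels in place of indices: entering a loop leaves the registers of the outer variables
-- where they are. Levels start at 1, as register 0 is the pointer.
level : ∀ {m} → Fin m → ℕ
level {suc m} zero    = suc m
level {suc m} (suc i) = level i

level≤ : ∀ {m} (i : Fin m) → level i ≤ m
level≤ zero    = ≤-refl
level≤ (suc i) = m≤n⇒m≤1+n (level≤ i)

level≢0 : ∀ {m} (i : Fin m) → level i ≢ 0
level≢0 zero    ()
level≢0 (suc i) = level≢0 i

module _ (I : Input) where

  private
    N = length (bits I)

  universe≤bits : universe I ≤ N
  universe≤bits = go (universe I)
    where
    go : ∀ n → n ≤ length (replicate n true ++ false ∷ tables I)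
    go zero    = z≤n
    go (suc n) = s≤s (go n)

  -- This is the loop test: with k elements done and l left, bit k of the unary prefix tells whether
  -- another one exists, and the separating `false` ends the loop.
  nth-bits : ∀ k l → k + l ≡ universe I → nth k (bits I) ≡ positive l
  nth-bits k l eq = go k (universe I) eq
    where
    go : ∀ k n → k + l ≡ n → nth k (replicate n true ++ false ∷ tables I) ≡ positive l
    go zero    zero    refl = refl
    go zero    (suc n) refl = refl
    go (suc k) (suc n) eq   = go k n (suc-injective eq)

  count-search : ∀ {X : Set} (F : X → Store → Store) c → (∀ x s → count (F x s) ≤ count s + c) →
                 ∀ xs s → count (searchOver F xs s) ≤ count s + length xs * c
  count-search F c le []       s = m≤m+n _ 0
  count-search F c le (x ∷ xs) s with flag (F x s)
  ... | true  = ≤-trans (le x s) (+-monoʳ-≤ (count s) (m≤m+n c _))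
  ... | false = ≤-trans (count-search F c le xs (F x s))
                  (≤-trans (+-monoˡ-≤ _ (le x s)) (≤-reflexive (+-assoc (count s) c _)))

  -- An operation raises the counter by at most one, so the number of operations also bounds the
  -- digits that an `emit` has to print.
  count-ops : ∀ {m} (P : Code m) env s → count (⟦ P ⟧ I env s) ≤ count s + ops P N
  count-ops (P ⨾ Q)      env s = ≤-trans (count-ops Q env _)
    (≤-trans (+-monoˡ-≤ _ (count-ops P env s)) (≤-reflexive (+-assoc (count s) _ _)))
  count-ops (ifFlag P Q) env s with flag s
  ... | true  = ≤-trans (count-ops P env s) (+-monoʳ-≤ (count s) (m≤n⇒m≤1+n (m≤m+n _ _)))
  ... | false = ≤-trans (count-ops Q env s) (+-monoʳ-≤ (count s) (m≤n⇒m≤1+n (m≤n+m _ _)))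
  count-ops (search P) env s = ≤-trans
    (count-search _ (1 + ops P N) (λ d s → ≤-trans (count-ops P (d ∷ env) s) (+-monoʳ-≤ (count s) (n≤1+n _)))
      (allFin (universe I)) _)
    (+-monoʳ-≤ (count s) (m≤n⇒m≤1+n (*-monoˡ-≤ (1 + ops P N)
      (≤-trans (≤-reflexive (length-tabulate id)) universe≤bits))))
  count-ops skip         env s = m≤m+n _ 1
  count-ops (flag≔ _)    env s = m≤m+n _ 1
  count-ops flip         env s = m≤m+n _ 1
  count-ops (less _ _)   env s = m≤m+n _ 1
  count-ops rewind       env s = m≤m+n _ 1
  count-ops advance      env s = m≤m+n _ 1
  count-ops readBit      env s = m≤m+n _ 1
  count-ops reset        env s = z≤n
  count-ops tick         env s = ≤-reflexive (+-comm 1 _)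
  count-ops emit         env s = m≤m+n _ 1

length-digits : ∀ c → length (digits (fromℕ' c)) ≤ c
length-digits zero    = z≤n
length-digits (suc c) = ≤-trans (length-digits-suc (fromℕ' c)) (s≤s (length-digits c))

-- Loop programs as tape programs

module Translate (K : ℕ) where

  open Alphabet K

  -- The bit just read decides on another round. It moves to `go` so that the body starts with a
  -- clear flag.
  startRound : Γ → Γ
  startRound (home f _) = home false f
  startRound x          = x

  flipFlag : Γ → Γ
  flipFlag (home f g) = home (not f) g
  flipFlag x          = x

  translate : ∀ {m} → Code m → Program {Γ}
  translate skip           = put id
  translate (P ⨾ Q)        = translate P » translate Q
  translate (ifFlag P Q)   = branch getFlag (translate P) (translate Q)
  -- All loops, nested ones and that of `emitCounter` included, share the bit `go`. Each round
  -- therefore clears it before the body and sets it again only from the input bit that the loop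
  -- variable points to.
  translate (search {m} P) = sweepRight (clearRule (suc m)) » sweepRight (readRule (suc m)) » put startRound »
    while getGo (put (setGo false) » translate P »
      branch getFlag (put id) (sweepRight (incRule (suc m)) » sweepRight (readRule (suc m)) » put startRound))
  translate (flag≔ b)      = put (setFlag b)
  translate flip           = put flipFlag
  translate (less i j)     = sweepRight (lessRule (level i) (level j))
  translate rewind         = sweepRight (clearRule 0)
  translate advance        = sweepRight (incRule 0)
  translate readBit        = sweepRight (readRule 0)
  translate reset          = sweepLeft zeroRule
  translate tick           = sweepLeft upRule
  translate emit           = emitCounter

  module _ (I : Input) (W : ℕ) where

    private
      N = length (bits I)

    -- The dearest operation is `emit`, with 9 + 7d sweeps for d digits; W bounds the counter and
    -- hence d.
    unit : ℕ
    unit = 9 + 7 * W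

    layout : Registers → Store → Bool → ℕ → ℕ → Tape Γ
    layout ρ s g i j =
      tape (counterCells (fromℕ' (count s)) i) (home (flag s) g) (rightCells ρ (bits I) (out s) j)

    -- Only the pointer and the variables in scope are constrained: registers of finished loops keep
    -- stale values, and every search clears its own register first.
    record Agree {m} (ρ : Registers) (env : Vec (Fin (universe I)) m) (s : Store) : Set where
      constructor agree
      field
        atPointer  : ρ 0 ≡ pointer s
        atVariable : ∀ i → ρ (level i) ≡ toℕ (Vec.lookup env i)
    open Agree

    record Simulates {m} (Q : Program) (S : ℕ) (ρ : Registers) (g : Bool) (env : Vec (Fin (universe I)) m)
                     (s s′ : Store) i j : Set where
      constructor simulates
      field
        {ρ′}    : Registers
        {i′ j′} : ℕ
        run     : Exec Q (layout ρ s g i j) S (layout ρ′ s′ false i′ j′)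
        agrees  : Agree ρ′ env s′

    agree-pointer : ∀ {m ρ} {env : Vec _ m} {s} v → Agree ρ env s → Agree (update 0 v ρ) env (record s { pointer = v })
    agree-pointer {ρ = ρ} v (agree p e) =
      agree refl (λ i → trans (update-other 0 v ρ (level i) (level≢0 i)) (e i))

    agree-fresh : ∀ {m ρ} {env : Vec _ m} {s} v → Agree ρ env s → Agree (update (suc m) v ρ) env s
    agree-fresh {m} {ρ} v (agree p e) = agree p
      (λ i → trans (update-other (suc m) v ρ (level i) (<⇒≢ (s≤s (level≤ i)))) (e i))

    variable≤ : ∀ {m ρ} {env : Vec _ m} {s} → Agree ρ env s → ∀ i → ρ (level i) ≤ N
    variable≤ ag i = ≤-trans (≤-reflexive (atVariable ag i)) (≤-trans (<⇒≤ (toℕ<n _)) (universe≤bits I))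

    exec-to : ∀ {Q : Program {Γ}} {T S U U′} → U ≡ U′ → Exec Q T S U → Exec Q T S U′
    exec-to refl e = e

    one : ∀ {Q : Program {Γ}} {T U} → Exec Q T 1 U → Exec Q T (1 * unit) U
    one = exec-slack (s≤s z≤n)

    round : ∀ {m} → Code (suc m) → Program
    round {m} P = put (setGo false) » translate P »
      branch getFlag (put id) (sweepRight (incRule (suc m)) » sweepRight (readRule (suc m)) » put startRound)

    translate-correct : ∀ {m} (P : Code m) → need P ≤ K → m < K → ∀ {ρ env} s i j →
      Agree ρ env s → count s + ops P N ≤ W →
      Simulates (translate P) (ops P N * unit) ρ false env s (⟦ P ⟧ I env s) i j

    -- Loop invariant: k elements are done, `f` lists the l remaining ones, the loop register holds
    -- k, and `go` says whether l is positive.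
    search-correct : ∀ {m} (P : Code (suc m)) → need P ≤ K → suc m < K →
      ∀ {ρ env} l k (f : Fin l → Fin (universe I)) →
      k + l ≡ universe I → (∀ x → toℕ (f x) ≡ k + toℕ x) → ∀ s i j → flag s ≡ false → Agree ρ env s →
      ρ (suc m) ≡ k → count s + l * (1 + ops P N) ≤ W →
      Simulates (while getGo (round P)) (1 + l * ((1 + ops P N) * unit)) ρ (positive l) env s
        (searchOver (λ d → ⟦ P ⟧ I (d ∷ env)) (tabulate f) s) i j

    -- The run of the body is an argument, so its final store is a variable that can be split on the
    -- flag: leave the loop, or move on to the next element.
    round-correct : ∀ {m} (P : Code (suc m)) → need P ≤ K → suc m < K →
      ∀ {ρ env} l k (f : Fin (suc l) → Fin (universe I)) →
      k + suc l ≡ universe I → (∀ x → toℕ (f x) ≡ k + toℕ x) → ∀ s s₁ i j → flag s ≡ false →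
      Simulates (translate P) (ops P N * unit) ρ false (f zero ∷ env) s s₁ i j →
      count s₁ + l * (1 + ops P N) ≤ W →
      Simulates (while getGo (round P)) (1 + suc l * ((1 + ops P N) * unit)) ρ true env s
        (if flag s₁ then s₁ else searchOver (λ d → ⟦ P ⟧ I (d ∷ env)) (tabulate (f ∘ suc)) s₁) i j
    round-correct P nd m<K l k f kl ft s (store true p c o) i j refl (simulates run₁ ag₁) cap = simulates
      (exec-slack (bound (ops P N * unit) _) (exec-again refl
        (exec-» (exec-stay {f = setGo false}) (exec-» run₁ (exec-then refl (exec-stay {f = id}))))
        (exec-stop refl)))
      (agree (atPointer ag₁) (λ i → atVariable ag₁ (suc i)))
      where
      bound : ∀ x r → suc (1 + (x + 2) + 1) ≤ 1 + ((unit + x) + r)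
      bound x r = begin
        suc (1 + (x + 2) + 1)  ≡⟨ arith x ⟩
        1 + (4 + x)            ≤⟨ s≤s (≤-trans (+-monoˡ-≤ x (m≤m+n 4 (5 + 7 * W))) (m≤m+n _ r)) ⟩
        1 + ((unit + x) + r)   ∎
        where
        open ≤-Reasoning
        arith : ∀ x → suc (1 + (x + 2) + 1) ≡ 1 + (4 + x)
        arith = solve-∀
    round-correct {m} P nd m<K {ρ} {env} l k f kl ft s s₁@(store false p c o) i j refl
      (simulates {ρ₁} {i₁} {j₁} run₁ ag₁) cap
      with exec-inc (bits I) m<K ρ₁ {counterCells (fromℕ' c) i₁} {false} {false} o j₁
    ... | j₂ , inc with exec-read (bits I) m<K (update (suc m) (suc (ρ₁ (suc m))) ρ₁)
                          {counterCells (fromℕ' c) i₁} {false} {false} o j₂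
    ... | j₃ , read with search-correct P nd m<K {update (suc m) (suc (ρ₁ (suc m))) ρ₁} {env} l (suc k) (f ∘ suc)
          (trans (sym (+-suc k l)) kl) (λ x → trans (ft (suc x)) (+-suc k (toℕ x))) s₁ i₁ j₃ refl
          (agree-fresh (suc (ρ₁ (suc m))) (agree (atPointer ag₁) (λ i → atVariable ag₁ (suc i))))
          now cap
          where
          now : update (suc m) (suc (ρ₁ (suc m))) ρ₁ (suc m) ≡ suc k
          now = trans (update-same (suc m) _ ρ₁)
                  (cong suc (trans (atVariable ag₁ zero) (trans (ft zero) (+-identityʳ k))))
    ... | simulates rest ag′ = simulates
      (exec-slack (bound (ops P N * unit) _) (exec-again refl
        (exec-» (exec-stay {f = setGo false}) (exec-» run₁ (exec-else refl
          (exec-» inc (exec-» read′ (exec-stay {f = startRound}))))))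
        rest))
      ag′
      where
      read′ : Exec (sweepRight (readRule (suc m)))
        (tape (counterCells (fromℕ' c) i₁) (home false false)
              (rightCells (update (suc m) (suc (ρ₁ (suc m))) ρ₁) (bits I) o j₂)) 1
        (tape (counterCells (fromℕ' c) i₁) (home (positive l) false)
              (rightCells (update (suc m) (suc (ρ₁ (suc m))) ρ₁) (bits I) o j₃))
      read′ = exec-to (cong (λ b → layout (update (suc m) (suc (ρ₁ (suc m))) ρ₁) (store b p c o) false i₁ j₃)
        (trans (cong (λ z → nth z (bits I)) (trans (update-same (suc m) _ ρ₁)
                  (cong suc (trans (atVariable ag₁ zero) (trans (ft zero) (+-identityʳ k))))))
               (nth-bits I (suc k) l (trans (sym (+-suc k l)) kl)))) read
      -- The overhead of 6 is the loop test, `setGo`, the branch, the increment, the read and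
      -- `startRound`; `unit` is at least 9.
      bound : ∀ x r → suc (1 + (x + suc (1 + (1 + 1))) + (1 + r)) ≤ 1 + ((unit + x) + r)
      bound x r = begin
        suc (1 + (x + suc (1 + (1 + 1))) + (1 + r)) ≡⟨ arith x r ⟩
        1 + ((6 + x) + r)      ≤⟨ s≤s (+-monoˡ-≤ r (+-monoˡ-≤ x (m≤m+n 6 (3 + 7 * W)))) ⟩
        1 + ((unit + x) + r)   ∎
        where
        open ≤-Reasoning
        arith : ∀ x r → suc (1 + (x + suc (1 + (1 + 1))) + (1 + r)) ≡ 1 + ((6 + x) + r)
        arith = solve-∀

    search-correct P nd m<K zero k f kl ft s i j refl ag ρk cap = simulates (exec-stop refl) ag
    search-correct {m} P nd m<K {ρ} {env} (suc l) k f kl ft s i j fl ag ρk cap =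
      round-correct P nd m<K l k f kl ft s _ i j fl
        (translate-correct P nd m<K s i j
          (agree (atPointer ag) λ { zero → trans ρk (sym (trans (ft zero) (+-identityʳ k))) ; (suc x) → atVariable ag x })
          (≤-trans (+-monoʳ-≤ (count s) (≤-trans (n≤1+n _) (m≤m+n (1 + ops P N) _))) cap))
        (≤-trans (+-monoˡ-≤ (l * (1 + ops P N))
          (≤-trans (count-ops I P (f zero ∷ env) s) (+-monoʳ-≤ (count s) (n≤1+n _))))
          (≤-trans (≤-reflexive (+-assoc (count s) _ _)) cap))

    translate-correct skip nd m<K s i j ag cap = simulates (one (exec-stay {f = id})) ag
    translate-correct (P ⨾ Q) nd m<K {ρ} {env} s i j ag cap
      with translate-correct P (≤-trans (m≤m⊔n (need P) (need Q)) nd) m<K {ρ} {env} s i j ag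
             (≤-trans (+-monoʳ-≤ (count s) (m≤m+n _ _)) cap)
    ... | simulates {_} {i₁} {j₁} e₁ ag₁
      with translate-correct Q (≤-trans (m≤n⊔m (need P) (need Q)) nd) m<K _ i₁ j₁ ag₁
             (≤-trans (+-monoˡ-≤ (ops Q N) (count-ops I P env s)) (≤-trans (≤-reflexive (+-assoc (count s) _ _)) cap))
    ... | simulates e₂ ag₂ = simulates
      (exec-slack (≤-reflexive (sym (*-distribʳ-+ unit (ops P N) (ops Q N)))) (exec-» e₁ e₂)) ag₂
    translate-correct (ifFlag P Q) nd m<K s@(store true _ c _) i j ag cap
      with translate-correct P (≤-trans (m≤m⊔n (need P) (need Q)) nd) m<K s i j ag
             (≤-trans (+-monoʳ-≤ c (m≤n⇒m≤1+n (m≤m+n _ _))) cap)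
    ... | simulates e ag₁ = simulates
      (exec-slack (+-mono-≤ (s≤s {0} {8 + 7 * W} z≤n) (*-monoˡ-≤ unit (m≤m+n (ops P N) (ops Q N)))) (exec-then refl e)) ag₁
    translate-correct (ifFlag P Q) nd m<K s@(store false _ c _) i j ag cap
      with translate-correct Q (≤-trans (m≤n⊔m (need P) (need Q)) nd) m<K s i j ag
             (≤-trans (+-monoʳ-≤ c (m≤n⇒m≤1+n (m≤n+m _ _))) cap)
    ... | simulates e ag₁ = simulates
      (exec-slack (+-mono-≤ (s≤s {0} {8 + 7 * W} z≤n) (*-monoˡ-≤ unit (m≤n+m (ops Q N) (ops P N)))) (exec-else refl e)) ag₁
    translate-correct (search {m} P) nd m<K {ρ} {env} s@(store b p c o) i j ag cap
      with exec-clear (bits I) (suc m) ρ {counterCells (fromℕ' c) i} {b} {false} o j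
    ... | j₁ , clear with exec-read (bits I) (≤-trans (m≤m⊔n (suc (suc m)) (need P)) nd) (update (suc m) 0 ρ)
                            {counterCells (fromℕ' c) i} {b} {false} o j₁
    ... | j₂ , read with search-correct P (≤-trans (m≤n⊔m (suc (suc m)) (need P)) nd)
                           (≤-trans (m≤m⊔n (suc (suc m)) (need P)) nd)
                           {update (suc m) 0 ρ} {env} (universe I) 0 id refl (λ _ → refl) (store false p c o) i j₂ refl
                           (agree (atPointer ag) (atVariable (agree-fresh 0 ag))) (update-same (suc m) 0 ρ)
                           (≤-trans (+-monoʳ-≤ c (m≤n⇒m≤1+n (*-monoˡ-≤ (1 + ops P N) (universe≤bits I)))) cap)
    ... | simulates rest ag′ = simulates
      (exec-slack bound (exec-» clear (exec-» read′ (exec-» (exec-stay {f = startRound}) rest)))) ag′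
      where
      read′ : Exec (sweepRight (readRule (suc m)))
        (tape (counterCells (fromℕ' c) i) (home b false) (rightCells (update (suc m) 0 ρ) (bits I) o j₁)) 1
        (tape (counterCells (fromℕ' c) i) (home (positive (universe I)) false) (rightCells (update (suc m) 0 ρ) (bits I) o j₂))
      read′ = exec-to (cong (λ b → layout (update (suc m) 0 ρ) (store b p c o) false i j₂)
        (trans (cong (λ z → nth z (bits I)) (update-same (suc m) 0 ρ)) (nth-bits I 0 (universe I) refl))) read
      bound : 1 + (1 + (1 + (1 + universe I * ((1 + ops P N) * unit)))) ≤ (1 + N * (1 + ops P N)) * unit
      -- The 4 are the clearing, the first read, `startRound` and the constant term of the loop.
      bound = +-mono-≤ {4} (m≤m+n 4 (5 + 7 * W))
        (≤-trans (*-monoˡ-≤ _ (universe≤bits I)) (≤-reflexive (sym (*-assoc N (1 + ops P N) unit))))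
    translate-correct (flag≔ b) nd m<K s i j ag cap =
      simulates (one (exec-stay {f = setFlag b})) (agree (atPointer ag) (atVariable ag))
    translate-correct flip nd m<K s i j ag cap =
      simulates (one (exec-stay {f = flipFlag})) (agree (atPointer ag) (atVariable ag))
    translate-correct (less x y) nd m<K {ρ} {env} s i j ag cap
      with exec-less (bits I) (≤-trans (s≤s (level≤ x)) m<K) (≤-trans (s≤s (level≤ y)) m<K) ρ (variable≤ ag y) (out s) j
    ... | j′ , e = simulates
      (one (exec-to (cong (λ b → layout ρ (record s { flag = b }) false i j′)
        (cong₂ _<ᵇ_ (atVariable ag x) (atVariable ag y))) e))
      (agree (atPointer ag) (atVariable ag))
    translate-correct rewind nd m<K {ρ} s i j ag cap with exec-clear (bits I) 0 ρ (out s) j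
    ... | j′ , e = simulates (one e) (agree-pointer 0 ag)
    translate-correct advance nd m<K {ρ} s i j ag cap with exec-inc (bits I) (≤-trans (s≤s z≤n) m<K) ρ (out s) j
    ... | j′ , e = simulates (one e) (subst (λ z → Agree (update 0 (suc z) ρ) _ (record s { pointer = suc (pointer s) }))
                     (sym (atPointer ag)) (agree-pointer (suc (pointer s)) ag))
    translate-correct readBit nd m<K {ρ} s i j ag cap with exec-read (bits I) (≤-trans (s≤s z≤n) m<K) ρ (out s) j
    ... | j′ , e = simulates
      (one (exec-to (cong (λ z → layout ρ (record s { flag = nth z (bits I) }) false i j′) (atPointer ag)) e))
      (agree (atPointer ag) (atVariable ag))
    translate-correct reset nd m<K s i j ag cap with exec-countReset (bits I) (fromℕ' (count s)) i
    ... | i′ , e = simulates (one e) (agree (atPointer ag) (atVariable ag))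
    translate-correct tick nd m<K s i j ag cap with exec-countUp (bits I) (fromℕ' (count s)) i
    ... | i′ , e = simulates (one e) (agree (atPointer ag) (atVariable ag))
    translate-correct emit nd m<K {ρ} s i j ag cap
      with exec-emitCounter (bits I) (fromℕ' (count s)) ρ (out s) i j {flag s}
    ... | i′ , j′ , e = simulates
      (exec-slack (≤-trans (+-monoʳ-≤ 9 (*-monoʳ-≤ 7 (≤-trans (length-digits (count s))
                    (≤-trans (m≤m+n _ 1) cap)))) (≤-reflexive (sym (*-identityˡ unit))))
        (exec-to (cong (λ x → layout ρ (record s { flag = false ; out = out s ++ encℕᵇ x }) false i′ j′)
                   (sym (fromℕ≡fromℕ' (count s)))) e))
      (agree (atPointer ag) (atVariable ag))

-- Polynomial time

PolyBounded : (ℕ → ℕ) → Set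
PolyBounded f = ∃₂ λ c k → ∀ N → f N ≤ c * suc N ^ k

poly-const : ∀ c → PolyBounded (λ _ → c)
poly-const c = c , 0 , λ N → ≤-reflexive (sym (*-identityʳ c))

poly-id : PolyBounded (λ N → N)
poly-id = 1 , 1 , λ N → ≤-trans (n≤1+n N) (≤-reflexive (sym (trans (*-identityˡ _) (*-identityʳ (suc N)))))

-- Adding the exponents is enough even for a sum: the base `suc N` is at least 1, so both powers lie
-- below the joint one.
poly-+ : ∀ {f g} → PolyBounded f → PolyBounded g → PolyBounded (λ N → f N + g N)
poly-+ (c , k , f≤) (d , l , g≤) = c + d , k + l , λ N → ≤-trans
  (+-mono-≤ (≤-trans (f≤ N) (*-monoʳ-≤ c (^-monoʳ-≤ (suc N) (m≤m+n k l))))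
            (≤-trans (g≤ N) (*-monoʳ-≤ d (^-monoʳ-≤ (suc N) (m≤n+m l k)))))
  (≤-reflexive (sym (*-distribʳ-+ (suc N ^ (k + l)) c d)))

poly-* : ∀ {f g} → PolyBounded f → PolyBounded g → PolyBounded (λ N → f N * g N)
poly-* (c , k , f≤) (d , l , g≤) = c * d , k + l , λ N → ≤-trans (*-mono-≤ (f≤ N) (g≤ N))
  (≤-reflexive (trans (interchange c (suc N ^ k) d (suc N ^ l))
    (cong (c * d *_) (sym (^-distribˡ-+-* (suc N) k l)))))
  where
  interchange : ∀ c x d y → c * x * (d * y) ≡ c * d * (x * y)
  interchange = solve-∀

poly-ops : ∀ {m} (P : Code m) → PolyBounded (ops P)
poly-ops (P ⨾ Q)      = poly-+ (poly-ops P) (poly-ops Q)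
poly-ops (ifFlag P Q) = poly-+ (poly-const 1) (poly-+ (poly-ops P) (poly-ops Q))
poly-ops (search P)   = poly-+ (poly-const 1) (poly-* poly-id (poly-+ (poly-const 1) (poly-ops P)))
poly-ops skip         = poly-const 1
poly-ops (flag≔ _)    = poly-const 1
poly-ops flip         = poly-const 1
poly-ops (less _ _)   = poly-const 1
poly-ops rewind       = poly-const 1
poly-ops advance      = poly-const 1
poly-ops readBit      = poly-const 1
poly-ops reset        = poly-const 1
poly-ops tick         = poly-const 1
poly-ops emit         = poly-const 1

-- The complete machine

module Main (P : Code 0) where

  -- One more than `need P`, so that the pointer has its register even in a program without loops.
  K : ℕ
  K = suc (need P)

  open Alphabet K
  open Translate K

  isBit : Γ → Bool
  isBit (bit _) = true
  isBit _       = false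

  convert : Γ → Γ
  convert (bit b) = input b (marks K (const 0))
  convert x       = x

  convert-plain : ∀ x → Plain x → Plain (convert x)
  convert-plain □           _ = refl
  convert-plain (bit _)     _ = refl
  convert-plain (digit _ _) _ = refl
  convert-plain (input _ _) _ = refl

  -- `setup` steps left onto a blank, which becomes home, and turns the raw bits into unmarked input
  -- cells. `finish` parks the head on the first output cell, where `output` starts reading.
  setup finish whole : Program {Γ}
  setup  = act (λ x → x , left) » put (const (home false false)) » sweepRight (rule isBit convert id nowhere same)
  finish = act (λ x → x , right) » while (onInput (λ _ _ → true)) (act (λ x → x , right))
  whole  = (setup » translate P) » finish

  exec-setup : ∀ b bs → Exec setup (inputTape (b ∷ bs)) 3
    (tape [] (home false false) (rightCells (const 0) (b ∷ bs) [] 1))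
  exec-setup b bs = exec-» leftwards (exec-» (exec-stay {f = const (home false false)})
    (exec-right (rule isBit convert id nowhere same) refl convert-plain refl
      (plain (b ∷ bs)) (converted (b ∷ bs)) refl))
    where
    leftwards : Exec (act (λ x → x , left)) (inputTape (b ∷ bs)) 1 (tape [] □ (map bit (b ∷ bs)))
    leftwards = exec (λ B _ → slack (s≤s z≤n) run-act) ≤-refl
    plain : ∀ bs → All Plain (map bit bs)
    plain []       = []
    plain (b ∷ bs) = refl ∷ plain bs
    converted : ∀ bs → swept isBit convert id (map bit bs) ≡ rightCells (const 0) bs [] 1
    converted []       = refl
    converted (b ∷ bs) = cong (_ ∷_) (converted bs)

  run-finish : ∀ ρ bs ls o j {f g} → ∃ λ ls′ → ∃₂ λ h rs →
    (finish ⊢ tape ls (home f g) (rightCells ρ bs o j) ⇓[ 1 + suc (2 * length bs) ] tape ls′ h rs) ×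
    (readSymbols (h ∷ rs) ≡ o)
  run-finish ρ bs ls o j {f} {g} with go ρ bs (home f g ∷ ls)
    where
    readBlanks : ∀ o j → readSymbols (written o j) ≡ o
    readBlanks []      zero    = refl
    readBlanks []      (suc j) = refl
    readBlanks (b ∷ o) j       = cong (b ∷_) (readBlanks o j)
    Goal : Registers → List Bool → List Γ → List Bool → ℕ → Set
    Goal ρ bs ls o j = ∃ λ ls′ → ∃₂ λ h rs →
      (while (onInput (λ _ _ → true)) (act (λ x → x , right)) ⊢ focus ls (rightCells ρ bs o j)
        ⇓[ suc (2 * length bs) ] tape ls′ h rs) × (readSymbols (h ∷ rs) ≡ o)
    atOutput : ∀ ρ ls o j → Goal ρ [] ls o j
    atOutput ρ ls []      zero    = ls , □ , [] , run-stop refl , refl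
    atOutput ρ ls []      (suc j) = ls , □ , blanks j , run-stop refl , refl
    atOutput ρ ls (b ∷ o) j       = ls , bit b , written o j , run-stop refl , cong (b ∷_) (readBlanks o j)
    go : ∀ ρ bs ls → Goal ρ bs ls o j
    go ρ [] ls = atOutput ρ ls o j
    go ρ (b ∷ bs) ls with go (pred ∘ ρ) bs (input b (marks K ρ) ∷ ls)
    ... | ls′ , h , rs , run , eq = ls′ , h , rs ,
      slack (≤-reflexive (cong suc (sym (*-suc 2 (length bs)))))
        (run-again refl (goRight ls _ _) run) , eq
  ... | ls′ , h , rs , run , eq = ls′ , h , rs , run-» (goRight ls _ _) run , eq

  -- The 3 are spent by `setup`. The counter starts at 0, so `ops P N` can serve as the bound W.
  sweeps : ℕ → ℕ
  sweeps N = 3 + ops P N * (9 + 7 * ops P N)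

  time : ℕ → ℕ
  time N = sweeps N * sweepTime {Aux} (sweeps N + N) + (1 + suc (2 * N))

  poly-time : PolyBounded time
  poly-time = poly-+ (poly-* poly-sweeps
      (poly-+ (poly-const 6) (poly-* (poly-const 4) (poly-+ poly-sweeps poly-id))))
    (poly-+ (poly-const 2) (poly-* (poly-const 2) poly-id))
    where
    poly-sweeps : PolyBounded sweeps
    poly-sweeps = poly-+ (poly-const 3) (poly-* (poly-ops P)
      (poly-+ (poly-const 9) (poly-* (poly-const 7) (poly-ops P))))

  cellCount-input : ∀ bs → cellCount (inputTape {Aux} bs) ≤ length bs
  cellCount-input []       = z≤n
  cellCount-input (b ∷ bs) = ≤-trans (≤-reflexive (length-map bit bs)) (n≤1+n _)

  whole-correct : ∀ (I : Input) b bs → Input.bits I ≡ b ∷ bs → ∃ λ ls → ∃₂ λ h rs →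
    (whole ⊢ inputTape (Input.bits I) ⇓[ time (length (Input.bits I)) ] tape ls h rs) ×
    (readSymbols (h ∷ rs) ≡ Store.out (⟦ P ⟧ I [] (store false 0 0 [])))
  whole-correct I b bs eq
    with translate-correct I (ops P (length (Input.bits I))) P (n≤1+n _) (s≤s z≤n) {const 0} {[]}
           (store false 0 0 []) 0 1
           (agree refl (λ ())) ≤-refl
  ... | simulates {ρ′} {i′} {j′} run _
    with run-finish ρ′ (Input.bits I) _ (Store.out (⟦ P ⟧ I [] (store false 0 0 []))) j′
  ... | ls , h , rs , final , reads = ls , h , rs , run-»
    (Exec.time (exec-» (subst (λ z → Exec setup (inputTape z) 3
                                  (tape [] (home false false) (rightCells (const 0) z [] 1)))
                         (sym eq) (exec-setup b bs)) run)
      _ (+-monoʳ-≤ (sweeps _) (cellCount-input (Input.bits I)))) final , reads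

  open Compile finite-Aux whole

  compute : ∀ (I : Input) {u} → time (length (Input.bits I)) ≤ u → ∃ λ cf →
    (runWithin machine u (initConfig machine (Input.bits I)) ≡ just cf) ×
    (output cf ≡ Store.out (⟦ P ⟧ I [] (store false 0 0 [])))
  compute I {u} t≤u = go (nonempty I)
    where
    -- Thanks to the separating `false` the input is never empty, so the initial tape has the shape
    -- that `exec-setup` expects.
    nonempty : ∀ I → ∃₂ λ b bs → Input.bits I ≡ b ∷ bs
    nonempty ⟪ zero  , ts ⟫ = false , ts , refl
    nonempty ⟪ suc n , ts ⟫ = true , _ , refl
    Result : List Bool → Set
    Result o = ∃ λ cf → (runWithin machine u (initConfig machine (Input.bits I)) ≡ just cf) × (output cf ≡ o)
    conclude : (∃ λ ls → ∃₂ λ h rs →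
      (whole ⊢ inputTape (Input.bits I) ⇓[ time (length (Input.bits I)) ] tape ls h rs) ×
      (readSymbols (h ∷ rs) ≡ Store.out (⟦ P ⟧ I [] (store false 0 0 [])))) →
      Result (Store.out (⟦ P ⟧ I [] (store false 0 0 [])))
    conclude (ls , h , rs , run , reads) = subst Result reads (computes run t≤u)
    go : (∃₂ λ b bs → Input.bits I ≡ b ∷ bs) → Result (Store.out (⟦ P ⟧ I [] (store false 0 0 [])))
    go (b , bs , eq) = conclude (whole-correct I b bs eq)

code-polytime : ∀ {X Y : Set} {encX : X → List Bool} {encY : Y → List Bool} {f : X → Y}
  (P : Code 0) (I : X → Input) → (∀ x → Input.bits (I x) ≡ encX x) →
  (∀ x → Store.out (⟦ P ⟧ (I x) [] (store false 0 0 [])) ≡ encY (f x)) → PolyTime encX encY f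
code-polytime {X} {Y} {encX} {encY} {f} P I input-eq output-eq = M , package (Main.poly-time P)
  where
  M : TM
  M = Compile.machine (Alphabet.finite-Aux (Main.K P)) (Main.whole P)
  Outcome : ℕ → List Bool → List Bool → Set
  Outcome t w o = Σ (Config M) λ cf → (runWithin M t (initConfig M w) ≡ just cf) × (output cf ≡ o)
  package : PolyBounded (Main.time P) →
    ∃₂ λ c k → ∀ x → Outcome (c * suc (length (encX x)) ^ k) (encX x) (encY (f x))
  package (c , k , bound) = c , k , λ x →
    subst₂ (λ w o → Outcome (c * suc (length w) ^ k) w o) (input-eq x) (output-eq x)
      (Main.compute P (I x) (bound _))

open Input

-- Evaluating formulas by loops

module _ {X : Set} {F : X → Store → Store} where

  searchOver-++ : ∀ xs ys s → flag s ≡ false → searchOver F (xs ++ ys) s ≡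
    (if flag (searchOver F xs s) then searchOver F xs s else searchOver F ys (searchOver F xs s))
  searchOver-++ []       ys s fl rewrite fl = refl
  searchOver-++ (x ∷ xs) ys s fl with flag (F x s) in eq
  ... | true  rewrite eq = refl
  ... | false = searchOver-++ xs ys (F x s) eq

  -- An inner search that succeeds leaves the flag set, which stops the outer one as well; so nested
  -- searches behave like one search over the flattened list.
  searchOver-concatMap : ∀ {Y : Set} (g : Y → List X) ys s → flag s ≡ false →
    searchOver F (concatMap g ys) s ≡ searchOver (λ y → searchOver F (g y)) ys s
  searchOver-concatMap g []       s fl = refl
  searchOver-concatMap g (y ∷ ys) s fl rewrite searchOver-++ (g y) (concatMap g ys) s fl
    with flag (searchOver F (g y) s) in eq
  ... | true  = refl
  ... | false = searchOver-concatMap g ys (searchOver F (g y) s) eq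

searchOver-map : ∀ {X Y : Set} {F : X → Store → Store} (g : Y → X) ys s →
  searchOver F (map g ys) s ≡ searchOver (F ∘ g) ys s
searchOver-map         g []       s = refl
searchOver-map {F = F} g (y ∷ ys) s with flag (F (g y) s)
... | true  = refl
... | false = searchOver-map g ys (F (g y) s)

module _ {X : Set} {F : X → Store → Store} {Ready : Store → Set}
  (step : ∀ x s → Ready s → flag (F x s) ≡ false → Ready (F x s)) where

  searchOver-ready : ∀ xs s → Ready s → flag (searchOver F xs s) ≡ false → Ready (searchOver F xs s)
  searchOver-ready []       s r fl = r
  searchOver-ready (x ∷ xs) s r fl with flag (F x s) in eq
  ... | true  = contradiction (trans (sym eq) fl) λ ()
  ... | false = searchOver-ready xs (F x s) (step x s r eq) fl

  -- The bodies need to agree only on ready stores, and readiness has to survive only those steps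
  -- after which the search goes on.
  searchOver-cong : ∀ {G} → (∀ x s → Ready s → G x s ≡ F x s) →
                    ∀ xs s → Ready s → searchOver G xs s ≡ searchOver F xs s
  searchOver-cong eq []       s r = refl
  searchOver-cong eq (x ∷ xs) s r rewrite eq x s r with flag (F x s) in fl
  ... | true  = refl
  ... | false = searchOver-cong eq xs (F x s) (step x s r fl)

-- Bodies of nested loops receive the weakening from the outer scope and the names of the new variables.
Body : ℕ → ℕ → Set
Body k m = ∀ {m′} → (Fin m → Fin m′) → Vec (Fin m′) k → Code m′

inner : ∀ {k m} → Body (suc k) m → Body k (suc m)
inner f ren vs = f (ren ∘ suc) (ren zero ∷ vs)

nest : ∀ k {m} → Body k m → Code m
nest zero    f = f id []
nest (suc k) f = search (nest k (inner f))

eqVar : ∀ {m} → Fin m → Fin m → Code m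
eqVar u v = less u v ⨾ ifFlag (flag≔ false) (less v u ⨾ flip)

eqTuple : ∀ {m k} → Vec (Fin m) k → Vec (Fin m) k → Code m
eqTuple []       []       = flag≔ true
eqTuple (u ∷ us) (v ∷ vs) = eqVar u v ⨾ ifFlag (eqTuple us vs) skip

-- A table of arity k has one bit per tuple, so running through the tuples moves the pointer past
-- it.
skipTuples : ∀ k {m} → Code m
skipTuples k = nest k (λ _ _ → advance ⨾ flag≔ false)

seek : ∀ {m} (σ : Vocabulary) → Fin (length σ) → Code m
seek (k ∷ σ) zero    = skip
seek (k ∷ σ) (suc i) = skipTuples k ⨾ seek σ i

-- The tuples are tried in the order in which the table lists their bits, so the pointer keeps pace
-- with the current tuple.
locate : ∀ {m k} → Vec (Fin m) k → Code m
locate us = nest _ (λ ren vs → eqTuple (Vec.map ren us) vs ⨾ ifFlag skip advance)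

-- The input is the universe in unary, a separating false, and the tables.
lookupAtom : ∀ {m} (σ : Vocabulary) (i : Fin (length σ)) → Vec (Fin m) (lookup σ i) → Code m
lookupAtom σ i us = rewind ⨾ flag≔ false ⨾ skipTuples 1 ⨾ advance ⨾ seek σ i ⨾ locate us ⨾ readBit ⨾ rewind

-- `us` holds the loop variables that stand for the free variables of the formula. A universal
-- quantifier is a search for a counterexample.
evaluate : ∀ {σ m m′} → Formula σ m → Vec (Fin m′) m → Code m′
evaluate {σ} (atom i xs) us = lookupAtom σ i (Vec.map (Vec.lookup us) xs)
evaluate (equal x y)  us = eqVar (Vec.lookup us x) (Vec.lookup us y)
evaluate (lessEq x y) us = less (Vec.lookup us y) (Vec.lookup us x) ⨾ flip
evaluate (neg φ)      us = evaluate φ us ⨾ flip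
evaluate (conj φ ψ)   us = evaluate φ us ⨾ ifFlag (evaluate ψ us) skip
evaluate (disj φ ψ)   us = evaluate φ us ⨾ ifFlag skip (evaluate ψ us)
evaluate (forAll φ)   us = search (evaluate φ (zero ∷ Vec.map suc us) ⨾ flip) ⨾ flip
evaluate (exists φ)   us = search (evaluate φ (zero ∷ Vec.map suc us))

module _ (I : Input) where

  private
    n = universe I

  -- By `searchOver-concatMap` the nested loops amount to a single search over `allTuples`, whose
  -- elements come in the same order. The condition on `ren` says that the variables from outside
  -- keep their values under the new binders.
  nest-correct : ∀ (Ready : Store → Set) → (∀ s → Ready s → flag s ≡ false) →
    ∀ k {m} (f : Body k m) (F : Vec (Fin n) k → Store → Store) env →
    (∀ z s → Ready s → flag (F z s) ≡ false → Ready (F z s)) →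
    (∀ {m′} (ren : Fin m → Fin m′) vs env′ s → (∀ i → Vec.lookup env′ (ren i) ≡ Vec.lookup env i) →
       Ready s → ⟦ f ren vs ⟧ I env′ s ≡ F (Vec.map (Vec.lookup env′) vs) s) →
    ∀ s → Ready s → ⟦ nest k f ⟧ I env s ≡ searchOver F (allTuples n k) s
  nest-correct Ready unset zero f F env step body s r =
    -- A search over one element ends in the same store whether or not its flag is set.
    trans (body id [] env s (λ _ → refl) r) (sym (if-eta (flag (F [] s))))
  nest-correct Ready unset (suc k) f F env step body s r = begin
    searchOver (λ d → ⟦ nest k (inner f) ⟧ I (d ∷ env)) (allFin n) (record s { flag = false })
      ≡⟨ cong (λ b → searchOver (λ d → ⟦ nest k (inner f) ⟧ I (d ∷ env)) (allFin n) (record s { flag = b }))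
           (sym (unset s r)) ⟩
    searchOver (λ d → ⟦ nest k (inner f) ⟧ I (d ∷ env)) (allFin n) s
      ≡⟨ searchOver-cong {Ready = Ready}
           (λ d → searchOver-ready {Ready = Ready} (λ z → step (d ∷ z)) (allTuples n k))
           (λ d → nest-correct Ready unset k (inner f) (λ z → F (d ∷ z)) (d ∷ env) (λ z → step (d ∷ z))
             (λ ren vs env′ s look r → trans (body (ren ∘ suc) (ren zero ∷ vs) env′ s (look ∘ suc) r)
               (cong (λ e → F (e ∷ Vec.map (Vec.lookup env′) vs) s) (look zero))))
           (allFin n) s r ⟩
    searchOver (λ d → searchOver (λ z → F (d ∷ z)) (allTuples n k)) (allFin n) s
      ≡⟨ searchOver-cong {Ready = Ready}
           (λ d s r → subst (λ t → flag t ≡ false → Ready t) (searchOver-map (d ∷_) (allTuples n k) s)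
             (searchOver-ready {Ready = Ready} step (map (d ∷_) (allTuples n k)) s r))
           (λ d s _ → searchOver-map (d ∷_) (allTuples n k) s) (allFin n) s r ⟨
    searchOver (λ d → searchOver F (map (d ∷_) (allTuples n k))) (allFin n) s
      ≡⟨ searchOver-concatMap (λ d → map (d ∷_) (allTuples n k)) (allFin n) s (unset s r) ⟨
    searchOver F (allTuples n (suc k)) s ∎
    where open ≡-Reasoning

  same? : ∀ {k} → Vec (Fin n) k → Vec (Fin n) k → Bool
  same? []       []       = true
  same? (x ∷ xs) (y ∷ ys) = if ⌊ x ≟ y ⌋ then same? xs ys else false

  same?-refl : ∀ {k} (xs : Vec (Fin n) k) → same? xs xs ≡ true
  same?-refl []       = refl
  same?-refl (x ∷ xs) with x ≟ x
  ... | yes _  = same?-refl xs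
  ... | no x≢x = contradiction refl x≢x

  same?-sound : ∀ {k} (xs ys : Vec (Fin n) k) → same? xs ys ≡ true → xs ≡ ys
  same?-sound []       []       _ = refl
  same?-sound (x ∷ xs) (y ∷ ys) eq with x ≟ y
  ... | yes refl = cong (x ∷_) (same?-sound xs ys eq)

  <ᵇ-irrefl : ∀ k → (k <ᵇ k) ≡ false
  <ᵇ-irrefl zero    = refl
  <ᵇ-irrefl (suc k) = <ᵇ-irrefl k

  less-split : ∀ (x y : Fin n) →
    (if toℕ x <ᵇ toℕ y then false else not (toℕ y <ᵇ toℕ x)) ≡ ⌊ x ≟ y ⌋
  less-split x y with x ≟ y
  ... | yes refl rewrite <ᵇ-irrefl (toℕ x) = refl
  ... | no x≢y = go (toℕ x) (toℕ y) (x≢y ∘ toℕ-injective)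
    where
    go : ∀ k l → k ≢ l → (if k <ᵇ l then false else not (l <ᵇ k)) ≡ false
    go zero    zero    ne = contradiction refl ne
    go zero    (suc l) ne = refl
    go (suc k) zero    ne = refl
    go (suc k) (suc l) ne = go k l (ne ∘ cong suc)

  eqVar-correct : ∀ {m} (u v : Fin m) env s →
    ⟦ eqVar u v ⟧ I env s ≡ record s { flag = ⌊ Vec.lookup env u ≟ Vec.lookup env v ⌋ }
  eqVar-correct u v env s rewrite sym (less-split (Vec.lookup env u) (Vec.lookup env v))
    with toℕ (Vec.lookup env u) <ᵇ toℕ (Vec.lookup env v)
  ... | true  = refl
  ... | false = refl

  eqTuple-correct : ∀ {m k} (us vs : Vec (Fin m) k) env s →
    ⟦ eqTuple us vs ⟧ I env s ≡
    record s { flag = same? (Vec.map (Vec.lookup env) us) (Vec.map (Vec.lookup env) vs) }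
  eqTuple-correct []       []       env s = refl
  eqTuple-correct (u ∷ us) (v ∷ vs) env s rewrite eqVar-correct u v env s
    with ⌊ Vec.lookup env u ≟ Vec.lookup env v ⌋
  ... | true  = eqTuple-correct us vs env (record s { flag = true })
  ... | false = refl

  -- The input from position p on reads `l`, both continued by `false` beyond their ends.
  At : ℕ → List Bool → Set
  At p l = ∀ k → nth (p + k) (bits I) ≡ nth k l

  at-suc : ∀ {p x l} → At p (x ∷ l) → At (suc p) l
  at-suc {p} at k = trans (cong (λ q → nth q (bits I)) (sym (+-suc p k))) (at (suc k))

  at-here : ∀ {p x l} → At p (x ∷ l) → nth p (bits I) ≡ x
  at-here {p} at = trans (cong (λ q → nth q (bits I)) (sym (+-identityʳ p))) (at 0)

  at-++ : ∀ {p} l {l′} → At p (l ++ l′) → At (p + length l) l′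
  at-++ {p} []      {l′} at = subst (λ q → At q l′) (sym (+-identityʳ p)) at
  at-++ {p} (x ∷ l) {l′} at = subst (λ q → At q l′) (sym (+-suc p (length l))) (at-++ l (at-suc {p} at))

  at-tables : At (suc n) (tables I)
  at-tables = go n
    where
    go : ∀ n k → nth (suc n + k) (replicate n true ++ false ∷ tables I) ≡ nth k (tables I)
    go zero    k = refl
    go (suc n) k = go n k

  skipTuples-correct : ∀ k {m} (env : Vec (Fin n) m) p c o →
    ⟦ skipTuples k ⟧ I env (store false p c o) ≡ store false (p + length (allTuples n k)) c o
  skipTuples-correct k env p c o = trans
    (nest-correct (λ s → flag s ≡ false) (λ _ r → r) k _ (λ _ s → record s { flag = false ; pointer = suc (pointer s) })
      env (λ _ _ _ fl → fl) (λ _ _ _ _ _ _ → refl) (store false p c o) refl)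
    (go (allTuples n k) p)
    where
    go : ∀ zs p → searchOver {Vec (Fin n) k} (λ _ s → record s { flag = false ; pointer = suc (pointer s) }) zs
                    (store false p c o) ≡ store false (p + length zs) c o
    go []       p = cong (λ q → store false q c o) (sym (+-identityʳ p))
    go (_ ∷ zs) p = trans (go zs (suc p)) (cong (λ q → store false q c o) (sym (+-suc p (length zs))))

  -- The interpretation is a separate argument so that induction on the vocabulary can strip one
  -- symbol at a time.
  tablesOf : ∀ (σ : Vocabulary) → ((i : Fin (length σ)) → Vec (Fin n) (lookup σ i) → Bool) → List Bool
  tablesOf σ R = concatMap (λ i → map (R i) (allTuples n (lookup σ i))) (allFin (length σ))

  concatMap-tabulate-suc : ∀ {l} (f : Fin (suc l) → List Bool) →
    concatMap f (tabulate suc) ≡ concatMap (f ∘ suc) (allFin l)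
  concatMap-tabulate-suc f = cong concat (trans (map-tabulate suc f) (sym (map-tabulate id (f ∘ suc))))

  seek-correct : ∀ (σ : Vocabulary) R i {m} (env : Vec (Fin n) m) p c o → At p (tablesOf σ R) → ∃₂ λ p′ l →
    (⟦ seek σ i ⟧ I env (store false p c o) ≡ store false p′ c o) ×
    At p′ (map (R i) (allTuples n (lookup σ i)) ++ l)
  seek-correct (k ∷ σ) R zero    env p c o at = p , _ , refl , at
  seek-correct (k ∷ σ) R (suc i) env p c o at =
    let p₁ , l , eq , at₁ = seek-correct σ (λ i → R (suc i)) i env (p + length (allTuples n k)) c o
          (subst₂ (λ x y → At (p + x) y) (length-map (R zero) (allTuples n k))
            (concatMap-tabulate-suc (λ i → map (R i) (allTuples n (lookup (k ∷ σ) i))))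
            (at-++ (map (R zero) (allTuples n k)) at))
    in p₁ , l , trans (cong (⟦ seek σ i ⟧ I env) (skipTuples-correct k env p c o)) eq , at₁

  locateStep : ∀ {k} → Vec (Fin n) k → Vec (Fin n) k → Store → Store
  locateStep x z s = if same? x z then record s { flag = true } else record s { flag = false ; pointer = suc (pointer s) }

  -- Each miss advances the list and the pointer together, so at the hit the pointer stands on the
  -- bit for `x`. Membership rules out running past the table.
  locate-correct : ∀ {k} R (x : Vec (Fin n) k) zs l p c o → x ∈ zs → At p (map R zs ++ l) → ∃ λ p′ →
    (searchOver (locateStep x) zs (store false p c o) ≡ store true p′ c o) × (nth p′ (bits I) ≡ R x)
  locate-correct R x (z ∷ zs) l p c o x∈ at with same? x z in eq | x∈
  ... | true  | _        = p , refl , trans (at-here {p} at) (cong R (sym (same?-sound x z eq)))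
  ... | false | here refl = contradiction (trans (sym eq) (same?-refl x)) λ ()
  ... | false | there x∈′ = locate-correct R x zs l (suc p) c o x∈′ (at-suc {p} at)

  ∈-allTuples : ∀ {k} (z : Vec (Fin n) k) → z ∈ allTuples n k
  ∈-allTuples []      = here refl
  ∈-allTuples (x ∷ z) = ∈-concatMap⁺ (λ y → map (y ∷_) (allTuples n _))
    (Any.map (λ { refl → ∈-map⁺ (x ∷_) (∈-allTuples z) }) (∈-allFin x))

  locate-search : ∀ {m k} (us : Vec (Fin m) k) env p c o →
    ⟦ locate us ⟧ I env (store false p c o) ≡
    searchOver (locateStep (Vec.map (Vec.lookup env) us)) (allTuples n k) (store false p c o)
  locate-search us env p c o = nest-correct (λ s → flag s ≡ false) (λ _ r → r) _ _
    (locateStep (Vec.map (Vec.lookup env) us)) env (λ _ _ _ fl → fl) body (store false p c o) refl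
    where
    body : ∀ {m′} (ren : _ → Fin m′) vs env′ s → (∀ i → Vec.lookup env′ (ren i) ≡ Vec.lookup env i) →
      flag s ≡ false → ⟦ eqTuple (Vec.map ren us) vs ⨾ ifFlag skip advance ⟧ I env′ s ≡
      locateStep (Vec.map (Vec.lookup env) us) (Vec.map (Vec.lookup env′) vs) s
    body ren vs env′ s look fl
      rewrite eqTuple-correct (Vec.map ren us) vs env′ s
            | sym (Vec.map-∘ (Vec.lookup env′) ren us) | Vec.map-cong look us
      with same? (Vec.map (Vec.lookup env) us) (Vec.map (Vec.lookup env′) vs)
    ... | true  = refl
    ... | false = refl

length-allTuples : ∀ n k → length (allTuples n k) ≡ n ^ k
length-allTuples n zero    = refl
length-allTuples n (suc k) = trans (go (allFin n)) (cong₂ _*_ (length-tabulate (id {A = Fin n})) (length-allTuples n k))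
  where
  go : ∀ xs → length (concatMap (λ x → map (x ∷_) (allTuples n k)) xs) ≡ length xs * length (allTuples n k)
  go []       = refl
  go (x ∷ xs) = trans (length-++ (map (x ∷_) (allTuples n k))) (cong₂ _+_ (length-map (x ∷_) (allTuples n k)) (go xs))

module _ {σ : Vocabulary} (A : Structure σ) where

  private
    n = size A

  inputOf : Input
  inputOf = ⟪ n , concatMap (λ i → map (rel A i) (allTuples n (lookup σ i))) (allFin (length σ)) ⟫

  lookupAtom-correct : ∀ {m} i (us : Vec (Fin m) (lookup σ i)) env f p c o →
    ⟦ lookupAtom σ i us ⟧ inputOf env (store f p c o) ≡ store (rel A i (Vec.map (Vec.lookup env) us)) 0 c o
  lookupAtom-correct {m} i us env f p c o = begin
    ⟦ advance ⨾ seek σ i ⨾ rest ⟧ inputOf env (⟦ skipTuples 1 ⟧ inputOf env (store false 0 c o))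
      ≡⟨ cong (⟦ advance ⨾ seek σ i ⨾ rest ⟧ inputOf env) (skipTuples-correct inputOf 1 env 0 c o) ⟩
    ⟦ rest ⟧ inputOf env (⟦ seek σ i ⟧ inputOf env (store false (suc (length (allTuples n 1))) c o))
      ≡⟨ cong (⟦ rest ⟧ inputOf env) sought ⟩
    ⟦ readBit ⨾ rewind ⟧ inputOf env (⟦ locate us ⟧ inputOf env (store false p₁ c o))
      ≡⟨ cong (⟦ readBit ⨾ rewind ⟧ inputOf env) (trans (locate-search inputOf us env p₁ c o) located) ⟩
    store (nth p₂ (bits inputOf)) 0 c o
      ≡⟨ cong (λ b → store b 0 c o) found ⟩
    store (rel A i (Vec.map (Vec.lookup env) us)) 0 c o ∎
    where
    open ≡-Reasoning
    rest : Code m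
    rest = locate us ⨾ readBit ⨾ rewind
    at : At inputOf (suc (length (allTuples n 1))) (tablesOf inputOf σ (rel A))
    at = subst (λ q → At inputOf (suc q) (tablesOf inputOf σ (rel A)))
           (sym (trans (length-allTuples n 1) (*-identityʳ n))) (at-tables inputOf)
    seeking = seek-correct inputOf σ (rel A) i env (suc (length (allTuples n 1))) c o at
    p₁      = proj₁ seeking
    sought  = proj₁ (proj₂ (proj₂ seeking))
    finding = locate-correct inputOf (rel A i) (Vec.map (Vec.lookup env) us) (allTuples n (lookup σ i)) _ p₁ c o
                (∈-allTuples inputOf _) (proj₂ (proj₂ (proj₂ seeking)))
    p₂      = proj₁ finding
    located = proj₁ (proj₂ finding)
    found   = proj₂ (proj₂ finding)

  -- The body must bring the pointer back to 0 and leave counter and output alone; this is why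
  -- `lookupAtom` ends with `rewind`.
  any-search : ∀ {X : Set} (F : X → Store → Store) (P : X → Bool) →
    (∀ x f c o → F x (store f 0 c o) ≡ store (P x) 0 c o) →
    ∀ xs c o → searchOver F xs (store false 0 c o) ≡ store (any P xs) 0 c o
  any-search F P eq []       c o = refl
  any-search F P eq (x ∷ xs) c o rewrite eq x false c o with P x
  ... | true  = refl
  ... | false = any-search F P eq xs c o

  not-any-not : ∀ {X : Set} (P : X → Bool) xs → not (any (not ∘ P) xs) ≡ all P xs
  not-any-not P []       = refl
  not-any-not P (x ∷ xs) with P x
  ... | true  = not-any-not P xs
  ... | false = refl

  not-<ᵇ : ∀ k l → not (l <ᵇ k) ≡ (k ≤ᵇ l)
  not-<ᵇ zero    zero    = refl
  not-<ᵇ zero    (suc l) = refl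
  not-<ᵇ (suc k) zero    = refl
  not-<ᵇ (suc k) (suc l) = trans (not-<ᵇ k l) (≤ᵇ-suc k l)
    where
    ≤ᵇ-suc : ∀ k l → (k ≤ᵇ l) ≡ (k <ᵇ suc l)
    ≤ᵇ-suc zero    l = refl
    ≤ᵇ-suc (suc k) l = refl

  extend : ∀ {m m′} d (env : Vec (Fin n) m′) (us : Vec (Fin m′) m) →
    Vec.map (Vec.lookup (d ∷ env)) (zero ∷ Vec.map suc us) ≡ d ∷ Vec.map (Vec.lookup env) us
  extend d env us = cong (d ∷_) (sym (Vec.map-∘ (Vec.lookup (d ∷ env)) suc us))

  evaluate-correct : ∀ {m m′} (φ : Formula σ m) (us : Vec (Fin m′) m) env f c o →
    ⟦ evaluate φ us ⟧ inputOf env (store f 0 c o) ≡ store (eval A φ (Vec.map (Vec.lookup env) us)) 0 c o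
  evaluate-correct (atom i xs) us env f c o = trans
    (lookupAtom-correct i (Vec.map (Vec.lookup us) xs) env f 0 c o)
    (cong (λ ws → store (rel A i ws) 0 c o)
      (trans (sym (Vec.map-∘ (Vec.lookup env) (Vec.lookup us) xs))
             (Vec.map-cong (λ x → sym (Vec.lookup-map x (Vec.lookup env) us)) xs)))
  evaluate-correct (equal x y) us env f c o
    rewrite Vec.lookup-map x (Vec.lookup env) us | Vec.lookup-map y (Vec.lookup env) us =
    eqVar-correct inputOf (Vec.lookup us x) (Vec.lookup us y) env (store f 0 c o)
  evaluate-correct (lessEq x y) us env f c o
    rewrite Vec.lookup-map x (Vec.lookup env) us | Vec.lookup-map y (Vec.lookup env) us =
    cong (λ b → store b 0 c o) (not-<ᵇ (toℕ (Vec.lookup env (Vec.lookup us x))) _)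
  evaluate-correct (neg φ) us env f c o rewrite evaluate-correct φ us env f c o = refl
  evaluate-correct (conj φ ψ) us env f c o rewrite evaluate-correct φ us env f c o
    with eval A φ (Vec.map (Vec.lookup env) us)
  ... | true  = evaluate-correct ψ us env true c o
  ... | false = refl
  evaluate-correct (disj φ ψ) us env f c o rewrite evaluate-correct φ us env f c o
    with eval A φ (Vec.map (Vec.lookup env) us)
  ... | true  = refl
  ... | false = evaluate-correct ψ us env false c o
  evaluate-correct (forAll φ) us env f c o = trans
    (cong (⟦ flip ⟧ inputOf env) (any-search _ (λ d → not (eval A φ (d ∷ Vec.map (Vec.lookup env) us)))
      (λ d f c o → trans (cong (⟦ flip ⟧ inputOf (d ∷ env)) (evaluate-correct φ _ (d ∷ env) f c o))
        (cong (λ ws → store (not (eval A φ ws)) 0 c o) (extend d env us)))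
      (allFin n) c o))
    (cong (λ b → store b 0 c o) (not-any-not (λ d → eval A φ (d ∷ Vec.map (Vec.lookup env) us)) (allFin n)))
  evaluate-correct (exists φ) us env f c o =
    any-search _ (λ d → eval A φ (d ∷ Vec.map (Vec.lookup env) us))
      (λ d f c o → trans (evaluate-correct φ _ (d ∷ env) f c o)
        (cong (λ ws → store (eval A φ ws) 0 c o) (extend d env us)))
      (allFin n) c o

-- Printing the formula

-- Along the list `ι` takes the values c, c+1, c+2, and so on, so a counter started at c and ticked
-- once per element always holds the index of the current element.
data Consecutive {X : Set} (ι : X → ℕ) : ℕ → List X → Set where
  []  : ∀ {c} → Consecutive ι c []
  _∷_ : ∀ {c x xs} → ι x ≡ c → Consecutive ι (suc c) xs → Consecutive ι c (x ∷ xs)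

consecutive-++ : ∀ {X : Set} {ι : X → ℕ} {c xs ys} → Consecutive ι c xs →
  Consecutive ι (c + length xs) ys → Consecutive ι c (xs ++ ys)
consecutive-++ {ι = ι} {c} {ys = ys} [] co = subst (λ d → Consecutive ι d ys) (+-identityʳ c) co
consecutive-++ {ι = ι} {c} {x ∷ xs} {ys} (eq ∷ co) co′ =
  eq ∷ consecutive-++ co (subst (λ d → Consecutive ι d ys) (+-suc c (length xs)) co′)

consecutive-map : ∀ {X Y : Set} {κ : Y → ℕ} {ι : X → ℕ} {g : X → Y} d → (∀ x → κ (g x) ≡ d + ι x) →
  ∀ {c xs} → Consecutive ι c xs → Consecutive κ (d + c) (map g xs)
consecutive-map d eq [] = []
consecutive-map {κ = κ} {g = g} d eq {c} {x ∷ xs} (refl ∷ co) =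
  eq x ∷ subst (λ e → Consecutive κ e (map g xs)) (+-suc d c) (consecutive-map d eq co)

-- `allTuples` is lexicographic, and `combine` weights the first entry by n^k: the block with first
-- entry j starts at index j * n^k.
consecutive-tuples : ∀ n k → Consecutive (toℕ ∘ tupleIndex {n} {k}) 0 (allTuples n k)
consecutive-tuples n zero    = refl ∷ []
consecutive-tuples n (suc k) = go n 0 id (λ _ → refl)
  where
  M = n ^ k
  go : ∀ l j (f : Fin l → Fin n) → (∀ x → toℕ (f x) ≡ j + toℕ x) →
    Consecutive (toℕ ∘ tupleIndex {n} {suc k}) (j * M) (concatMap (λ x → map (x ∷_) (allTuples n k)) (tabulate f))
  go zero    j f ft = []
  go (suc l) j f ft = consecutive-++
    (subst (λ c → Consecutive (toℕ ∘ tupleIndex {n} {suc k}) c (map (f zero ∷_) (allTuples n k))) (+-identityʳ (j * M))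
      (consecutive-map (j * M) (λ z → trans (toℕ-combine (f zero) (tupleIndex z))
          (cong (_+ toℕ (tupleIndex z)) (trans (*-comm M (toℕ (f zero))) (cong (_* M) (trans (ft zero) (+-identityʳ j))))))
        (consecutive-tuples n k)))
    (subst (λ c → Consecutive (toℕ ∘ tupleIndex {n} {suc k}) c
                   (concatMap (λ x → map (x ∷_) (allTuples n k)) (tabulate (f ∘ suc))))
      (trans (+-comm M (j * M)) (cong (j * M +_) (sym (trans
        (length-map (f zero ∷_) (allTuples n k)) (length-allTuples n k)))))
      (go l (suc j) (f ∘ suc) (λ x → trans (ft (suc x)) (+-suc j (toℕ x)))))

Ready : Store → Set
Ready s = (flag s ≡ false) × (pointer s ≡ 0)

countTuples : ∀ k {m} → Code m
countTuples k = nest k (λ _ _ → tick ⨾ flag≔ false)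

countTuples-correct : ∀ (I : Input) k {m} (env : Vec (Fin (universe I)) m) c o →
  ⟦ countTuples k ⟧ I env (store false 0 c o) ≡ store false 0 (c + universe I ^ k) o
countTuples-correct I k env c o = trans
  (nest-correct I Ready (λ _ → proj₁) k _ (λ _ s → record s { flag = false ; count = suc (count s) }) env
    (λ _ _ r _ → refl , proj₂ r) (λ _ _ _ _ _ _ → refl) (store false 0 c o) (refl , refl))
  (trans (go (allTuples (universe I) k) c)
         (cong (λ l → store false 0 (c + l) o) (length-allTuples (universe I) k)))
  where
  go : ∀ zs c → searchOver {Vec (Fin (universe I)) k} (λ _ s → record s { flag = false ; count = suc (count s) }) zs
                  (store false 0 c o) ≡ store false 0 (c + length zs) o
  go []       c = cong (λ q → store false 0 q o) (sym (+-identityʳ c))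
  go (_ ∷ zs) c = trans (go zs (suc c)) (cong (λ q → store false 0 q o) (sym (+-suc c (length zs))))

module _ {X : Set} (P : X → Bool) where

  countStep : X → Store → Store
  countStep x s = if P x then record s { flag = false ; count = suc (count s) } else record s { flag = false }

  count-selected : ∀ xs c o → searchOver countStep xs (store false 0 c o) ≡
    store false 0 (c + length (filterᵇ P xs)) o
  count-selected []       c o = cong (λ q → store false 0 q o) (sym (+-identityʳ c))
  count-selected (x ∷ xs) c o with P x
  ... | true  = trans (count-selected xs (suc c) o)
                  (cong (λ q → store false 0 q o) (sym (+-suc c (length (filterᵇ P xs)))))
  ... | false = count-selected xs c o

  emitStep : X → Store → Store
  emitStep x s = if P x then record s { flag = false ; count = suc (count s) ; out = out s ++ encℕ (count s) }
                 else record s { flag = false ; count = suc (count s) }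

  -- The counter ticks for rejected elements too, so at a selected one it holds exactly the index to
  -- print.
  emit-selected : ∀ (ι : X → ℕ) xs c o → Consecutive ι c xs →
    searchOver emitStep xs (store false 0 c o) ≡
    store false 0 (c + length xs) (o ++ concatMap (λ x → encℕ (ι x)) (filterᵇ P xs))
  emit-selected ι []       c o []         = cong₂ (store false 0) (sym (+-identityʳ c)) (sym (++-identityʳ o))
  emit-selected ι (x ∷ xs) c o (refl ∷ co) with P x
  ... | true  = trans (emit-selected ι xs (suc c) (o ++ encℕ c) co)
                  (cong₂ (store false 0) (sym (+-suc c (length xs))) (++-assoc o (encℕ c) _))
  ... | false = trans (emit-selected ι xs (suc c) o co)
                  (cong (λ q → store false 0 q (o ++ concatMap (λ x → encℕ (ι x)) (filterᵇ P xs)))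
                    (sym (+-suc c (length xs))))

-- The monotone formula and the program that prints it

module Reduction {σ : Vocabulary} (a b : ℕ) (φ : Formula σ (a + b)) where

  -- There is no room to store the selection, so the second pass evaluates φ afresh. Evaluation
  -- leaves the counter alone, and clearing the flag after each tuple keeps the search from stopping
  -- early.
  countSelected emitSelected clauseCode : ∀ {m} → Vec (Fin m) a → Code m
  countSelected ys = nest b (λ ren zs → evaluate φ (Vec.map ren ys Vec.++ zs) ⨾ ifFlag tick skip ⨾ flag≔ false)
  emitSelected ys  = nest b (λ ren zs → evaluate φ (Vec.map ren ys Vec.++ zs) ⨾ ifFlag emit skip ⨾ tick ⨾ flag≔ false)
  clauseCode ys    = reset ⨾ countSelected ys ⨾ emit ⨾ reset ⨾ emitSelected ys

  formulaCode : Code 0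
  formulaCode = countTuples b ⨾ emit ⨾ reset ⨾ countTuples a ⨾ emit ⨾ nest a (λ _ ys → clauseCode ys)

  module _ (A : Structure σ) where

    private
      n = size A
      I = inputOf A

    selects : Vec (Fin n) a → Vec (Fin n) b → Bool
    selects y z = eval A φ (y Vec.++ z)

    selected : Vec (Fin n) a → List (Vec (Fin n) b)
    selected y = filterᵇ (selects y) (allTuples n b)

    -- All n^b variables are declared, also those in no clause: such a tuple is a free bit of X as
    -- well, so no correcting factor arises. A `y` without admissible `z` gives the empty clause,
    -- which fails for every X like the sentence itself.
    monotone : MonCNF
    monotone = record { nvars = n ^ b ; clauses = map (λ y → map tupleIndex (selected y)) (allTuples n a) }

    encClause : Vec (Fin n) a → List Bool
    encClause y = encList encFin (map tupleIndex (selected y))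

    encClause-eq : ∀ y → encClause y ≡
      encℕ (length (selected y)) ++ concatMap (λ z → encℕ (toℕ (tupleIndex z))) (selected y)
    encClause-eq y = cong₂ _++_ (cong encℕ (length-map tupleIndex (selected y)))
      (concatMap-map encFin tupleIndex (selected y))

    evaluate-selects : ∀ {m m′} (ys : Vec (Fin m) a) env (ren : Fin m → Fin m′) zs env′ c o →
      (∀ i → Vec.lookup env′ (ren i) ≡ Vec.lookup env i) →
      ⟦ evaluate φ (Vec.map ren ys Vec.++ zs) ⟧ I env′ (store false 0 c o) ≡
      store (selects (Vec.map (Vec.lookup env) ys) (Vec.map (Vec.lookup env′) zs)) 0 c o
    evaluate-selects ys env ren zs env′ c o look = trans (evaluate-correct A φ _ env′ false c o)
      (cong (λ ws → store (eval A φ ws) 0 c o)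
        (trans (Vec.map-++ (Vec.lookup env′) (Vec.map ren ys) zs)
          (cong (Vec._++ _) (trans (sym (Vec.map-∘ (Vec.lookup env′) ren ys)) (Vec.map-cong look ys)))))

    countSelected-correct : ∀ {m} (ys : Vec (Fin m) a) env c o → ⟦ countSelected ys ⟧ I env (store false 0 c o) ≡
      store false 0 (c + length (selected (Vec.map (Vec.lookup env) ys))) o
    countSelected-correct ys env c o = trans
      (nest-correct I Ready (λ _ → proj₁) b _ (countStep (selects y)) env keep body (store false 0 c o) (refl , refl))
      (count-selected (selects y) (allTuples n b) c o)
      where
      y = Vec.map (Vec.lookup env) ys
      keep : ∀ z s → Ready s → flag (countStep (selects y) z s) ≡ false → Ready (countStep (selects y) z s)
      keep z s (_ , p0) fl with selects y z
      ... | true  = refl , p0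
      ... | false = refl , p0
      body : ∀ {m′} (ren : _ → Fin m′) zs env′ s →
        (∀ i → Vec.lookup env′ (ren i) ≡ Vec.lookup env i) → Ready s →
        ⟦ evaluate φ (Vec.map ren ys Vec.++ zs) ⨾ ifFlag tick skip ⨾ flag≔ false ⟧ I env′ s ≡
        countStep (selects y) (Vec.map (Vec.lookup env′) zs) s
      body ren zs env′ (store _ _ c o) look (refl , refl)
        rewrite evaluate-selects ys env ren zs env′ c o look
        with selects y (Vec.map (Vec.lookup env′) zs)
      ... | true  = refl
      ... | false = refl

    emitSelected-correct : ∀ {m} (ys : Vec (Fin m) a) env o →
      ⟦ emitSelected ys ⟧ I env (store false 0 0 o) ≡
      store false 0 (length (allTuples n b))
        (o ++ concatMap (λ z → encℕ (toℕ (tupleIndex z))) (selected (Vec.map (Vec.lookup env) ys)))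
    emitSelected-correct ys env o = trans
      (nest-correct I Ready (λ _ → proj₁) b _ (emitStep (selects y)) env keep body
        (store false 0 0 o) (refl , refl))
      (emit-selected (selects y) (toℕ ∘ tupleIndex) (allTuples n b) 0 o (consecutive-tuples n b))
      where
      y = Vec.map (Vec.lookup env) ys
      keep : ∀ z s → Ready s → flag (emitStep (selects y) z s) ≡ false → Ready (emitStep (selects y) z s)
      keep z s (_ , p0) fl with selects y z
      ... | true  = refl , p0
      ... | false = refl , p0
      body : ∀ {m′} (ren : _ → Fin m′) zs env′ s →
        (∀ i → Vec.lookup env′ (ren i) ≡ Vec.lookup env i) → Ready s →
        ⟦ evaluate φ (Vec.map ren ys Vec.++ zs) ⨾ ifFlag emit skip ⨾ tick ⨾ flag≔ false ⟧ I env′ s ≡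
        emitStep (selects y) (Vec.map (Vec.lookup env′) zs) s
      body ren zs env′ (store _ _ c o) look (refl , refl)
        rewrite evaluate-selects ys env ren zs env′ c o look
        with selects y (Vec.map (Vec.lookup env′) zs)
      ... | true  = refl
      ... | false = refl

    clauseStep : Vec (Fin n) a → Store → Store
    clauseStep y s = record s { flag = false ; count = length (allTuples n b) ; out = out s ++ encClause y }

    clauseCode-correct : ∀ {m} (ys : Vec (Fin m) a) env s → Ready s →
      ⟦ clauseCode ys ⟧ I env s ≡ clauseStep (Vec.map (Vec.lookup env) ys) s
    clauseCode-correct ys env (store _ _ c o) (refl , refl) = begin
      ⟦ emit ⨾ reset ⨾ emitSelected ys ⟧ I env (⟦ countSelected ys ⟧ I env (store false 0 0 o))
        ≡⟨ cong (⟦ emit ⨾ reset ⨾ emitSelected ys ⟧ I env) (countSelected-correct ys env 0 o) ⟩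
      ⟦ emitSelected ys ⟧ I env (store false 0 0 (o ++ encℕ (length (selected y))))
        ≡⟨ emitSelected-correct ys env (o ++ encℕ (length (selected y))) ⟩
      store false 0 _ ((o ++ encℕ (length (selected y))) ++ _)
        ≡⟨ cong (store false 0 _) (trans (++-assoc o _ _) (cong (o ++_) (sym (encClause-eq y)))) ⟩
      clauseStep y (store false 0 c o) ∎
      where
      open ≡-Reasoning
      y = Vec.map (Vec.lookup env) ys

    clauses-search : ∀ ys c o → out (searchOver clauseStep ys (store false 0 c o)) ≡ o ++ concatMap encClause ys
    clauses-search []       c o = sym (++-identityʳ o)
    clauses-search (y ∷ ys) c o = trans (clauses-search ys _ (o ++ encClause y)) (++-assoc o (encClause y) _)

    formulaCode-correct : out (⟦ formulaCode ⟧ I [] (store false 0 0 [])) ≡ encMonCNF monotone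
    formulaCode-correct = begin
      out (⟦ emit ⨾ reset ⨾ countTuples a ⨾ emit ⨾ clauseLoop ⟧ I [] (⟦ countTuples b ⟧ I [] (store false 0 0 [])))
        ≡⟨ cong (out ∘ ⟦ emit ⨾ reset ⨾ countTuples a ⨾ emit ⨾ clauseLoop ⟧ I []) (countTuples-correct I b [] 0 []) ⟩
      out (⟦ emit ⨾ clauseLoop ⟧ I [] (⟦ countTuples a ⟧ I [] (store false 0 0 (encℕ (n ^ b)))))
        ≡⟨ cong (out ∘ ⟦ emit ⨾ clauseLoop ⟧ I []) (countTuples-correct I a [] 0 (encℕ (n ^ b))) ⟩
      out (⟦ clauseLoop ⟧ I [] (store false 0 (n ^ a) (encℕ (n ^ b) ++ encℕ (n ^ a))))
        ≡⟨ cong out (nest-correct I Ready (λ _ → proj₁) a (λ _ ys → clauseCode ys) clauseStep []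
             (λ _ _ r _ → refl , proj₂ r) (λ _ ys env s _ → clauseCode-correct ys env s) _ (refl , refl)) ⟩
      out (searchOver clauseStep (allTuples n a) (store false 0 (n ^ a) (encℕ (n ^ b) ++ encℕ (n ^ a))))
        ≡⟨ clauses-search (allTuples n a) _ _ ⟩
      (encℕ (n ^ b) ++ encℕ (n ^ a)) ++ concatMap encClause (allTuples n a)
        ≡⟨ ++-assoc (encℕ (n ^ b)) _ _ ⟩
      encℕ (n ^ b) ++ encℕ (n ^ a) ++ concatMap encClause (allTuples n a)
        ≡⟨ cong (encℕ (n ^ b) ++_) (cong₂ _++_
             (cong encℕ (sym (trans (length-map _ (allTuples n a)) (length-allTuples n a))))
             (sym (concatMap-map (encList encFin) (λ y → map tupleIndex (selected y)) (allTuples n a)))) ⟩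
      encMonCNF monotone ∎
      where
      open ≡-Reasoning
      clauseLoop : Code 0
      clauseLoop = nest a (λ _ ys → clauseCode ys)

-- Equality of the two counts

all-map : ∀ {X Y : Set} (p : Y → Bool) (f : X → Y) xs → all p (map f xs) ≡ all (p ∘ f) xs
all-map p f []       = refl
all-map p f (x ∷ xs) = cong (p (f x) ∧_) (all-map p f xs)

all-cong : ∀ {X : Set} {p q : X → Bool} → (∀ x → p x ≡ q x) → ∀ xs → all p xs ≡ all q xs
all-cong eq []       = refl
all-cong eq (x ∷ xs) = cong₂ _∧_ (eq x) (all-cong eq xs)

-- Here the existential quantifier becomes a clause: φ does not depend on X, so it can decide
-- beforehand which literals are kept.
any-map-filter : ∀ {X Y : Set} (p : X → Bool) (q : Y → Bool) (f : X → Y) xs →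
  any (λ x → p x ∧ q (f x)) xs ≡ any q (map f (filterᵇ p xs))
any-map-filter p q f []       = refl
any-map-filter p q f (x ∷ xs) with p x
... | true  = cong (q (f x) ∨_) (any-map-filter p q f xs)
... | false = any-map-filter p q f xs

countTrue-cong : ∀ {X : Set} {p q : X → Bool} → (∀ x → p x ≡ q x) → ∀ xs → countTrue p xs ≡ countTrue q xs
countTrue-cong eq []       = refl
countTrue-cong eq (x ∷ xs) = cong₂ (λ c k → (if c then 1 else 0) + k) (eq x) (countTrue-cong eq xs)

theorem5 : (σ : Vocabulary) (a b : ℕ) (φ : Formula σ (a + b)) →
    Σ (Structure σ → MonCNF) λ g → Σ (Structure σ → ℕ) λ h →
    PolyTime encStructure encMonCNF g
    × PolyTime encStructure encℕ h
    × ((A : Structure σ) → countΠ2 a b φ A ≡ #MonotoneSat (g A) * h A)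
theorem5 σ a b φ = monotone , (λ _ → 1) ,
  code-polytime {encY = encMonCNF} {monotone} formulaCode inputOf (λ _ → refl) formulaCode-correct ,
  -- The constant 1 is printed by ticking the fresh counter once and emitting it.
  code-polytime {encY = encℕ} {λ _ → 1} (tick ⨾ emit) inputOf (λ _ → refl) (λ _ → refl) ,
  -- A relation on b-tuples and an assignment to the n^b variables are the same Boolean vector, so
  -- it suffices that the two predicates agree on each.
  λ A → trans
    (countTrue-cong (λ X → trans
        (all-cong (λ y → any-map-filter (selects A y) (Vec.lookup X) tupleIndex (allTuples (size A) b))
          (allTuples (size A) a))
        (sym (all-map _ _ (allTuples (size A) a))))
      (allBoolVecs (size A ^ b)))
    (sym (*-identityʳ _))
  where open Reduction a b φ
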